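{- Let $k$ be an even positive integer, let $G$ be a graph in which every vertex has even degree, and let $f:V(G)\to\mathbb{Z}_2$ be a mapping with $\sum_{v\in V(G)} f(v)\equiv 0\pmod 2$. If $d_G(X)\ge 3k-2$ for every vertex set $X$ with $\sum_{v\in X} f(v)$ odd, or if $G$ is $(2k-2)$-tree-connected, then $G$ can be edge-decomposed into $f$-parity factors $G_1,\ldots,G_k$ such that for each $i$ and each vertex $v$, $$|d_{G_i}(v)-d_G(v)/k|<2.$$
   Context: Graphs are finite and may have loops and multiple edges; a loop contributes $2$ to the degree $d_G(v)$. For a vertex set $X$, $d_G(X)$ denotes the number of edges with exactly one end in $X$. A graph is $m$-tree-connected if it contains $m$ edge-disjoint spanning trees. An $f$-parity factor is a spanning subgraph $F$ such that $d_F(v)\equiv f(v)\pmod 2$ for every vertex $v$. "Edge-decomposed into factors" means the edge set is partitioned into the edge sets of spanning subgraphs. -}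

module Defs where

open import Data.Nat using (ℕ; zero; suc; _+_; _*_; _∸_; _≤_; _<_; _%_)
open import Data.Fin using (Fin; zero; suc; _≟_)
open import Data.Bool using (Bool; true; false; _∧_; _xor_)
open import Data.Product using (_×_; _,_; proj₁; proj₂; Σ)
open import Relation.Nullary using (¬_; does)
open import Relation.Binary.PropositionalEquality using (_≡_)

sumFin : (m : ℕ) → (Fin m → ℕ) → ℕ
sumFin zero    g = 0
sumFin (suc m) g = g zero + sumFin m (λ i → g (suc i))

b2n : Bool → ℕ
b2n true  = 1
b2n false = 0

-- A (multi)graph with loops: vertex set Fin n, edges indexed by Fin m,
-- each edge given by its (unordered) pair of ends.  A loop has equal ends.
record Graph : Set where
  constructor graph
  field
    n    : ℕ
    m    : ℕ
    ends : Fin m → Fin n × Fin n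
open Graph public

Vertex : Graph → Set
Vertex G = Fin (n G)

Edge : Graph → Set
Edge G = Fin (m G)

-- a spanning subgraph, given by the characteristic function of its edge set
EdgeSet : Graph → Set
EdgeSet G = Edge G → Bool

-- number of ends of edge e at v (a loop contributes 2)
incid : (G : Graph) → Edge G → Vertex G → ℕ
incid G e v = b2n (does (proj₁ (ends G e) ≟ v)) + b2n (does (proj₂ (ends G e) ≟ v))

degIn : (G : Graph) → EdgeSet G → Vertex G → ℕ
degIn G S v = sumFin (m G) (λ e → b2n (S e) * incid G e v)

allE : (G : Graph) → EdgeSet G
allE G e = true

deg : (G : Graph) → Vertex G → ℕ
deg G = degIn G (allE G)

size : (G : Graph) → EdgeSet G → ℕ
size G S = sumFin (m G) (λ e → b2n (S e))

VSet : Graph → Set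
VSet G = Vertex G → Bool

cut : (G : Graph) → VSet G → ℕ
cut G X = sumFin (m G) (λ e → b2n (X (proj₁ (ends G e)) xor X (proj₂ (ends G e))))

-- Σ_{v ∈ X} f(v) computed in ℕ (f valued in ℤ₂ = Bool); parity taken with % 2
fsum : (G : Graph) → (Vertex G → Bool) → VSet G → ℕ
fsum G f X = sumFin (n G) (λ v → b2n (X v ∧ f v))

data Reach (G : Graph) (S : EdgeSet G) : Vertex G → Vertex G → Set where
  here : ∀ {u} → Reach G S u u
  fwd  : ∀ {u} (e : Edge G) → S e ≡ true →
         Reach G S u (proj₁ (ends G e)) → Reach G S u (proj₂ (ends G e))
  bwd  : ∀ {u} (e : Edge G) → S e ≡ true →
         Reach G S u (proj₂ (ends G e)) → Reach G S u (proj₁ (ends G e))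

Connected : (G : Graph) → EdgeSet G → Set
Connected G S = ∀ u v → Reach G S u v

IsSpanningTree : (G : Graph) → EdgeSet G → Set
IsSpanningTree G S = Connected G S × size G S ≡ n G ∸ 1

TreeConnected : ℕ → Graph → Set
TreeConnected s G =
  Σ (Fin s → EdgeSet G) λ T →
    ((j : Fin s) → IsSpanningTree G (T j)) ×
    (∀ j j' e → T j e ≡ true → T j' e ≡ true → j ≡ j')

IsParityFactor : (G : Graph) → (Vertex G → Bool) → EdgeSet G → Set
IsParityFactor G f S = ∀ v → degIn G S v % 2 ≡ b2n (f v)

-- the factor G_i of a decomposition c : E(G) → Fin k
factor : (G : Graph) {k : ℕ} → (Edge G → Fin k) → Fin k → EdgeSet G
factor G c i e = does (c e ≟ i)

allV : (G : Graph) → VSet G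
allV G v = true

{-# OPTIONS --safe #-}
module Submission where

-- Both hypotheses imply that every X with f(X) odd has cut at least 2(k − 1).  This already yields
-- k − 1 edge-disjoint f-parity factors; as k and all degrees are even, the remaining edges form
-- another one.  To pack m = k − 1 factors, orient G as an Eulerian digraph, so that every X with f(X)
-- odd has indegree at least m.  Take a minimal nonempty A of indegree less than m; then f(A) is even.
-- Contract A to a vertex a and split a off completely, keeping all odd cuts large (Lovász uncrossing),
-- pack the smaller graph by induction and lift the packing back.  By Edmonds' theorem on disjoint
-- branchings, the roots being the heads of the arcs entering A, the graph induced on A has m
-- disjoint spanning arborescences, and inside each of them one factor is completed.
--
-- The degrees are equalised by recolouring two factors at a time: let Q be their union and R one of
-- them.  In an Eulerian orientation of Q reversed on R, outdegrees are congruent mod 2 to d_Q/2 + f.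
-- Split each v into a tail copy and a head copy, joined by an extra edge if the outdegree of v is odd,
-- orient this bipartite graph Eulerianly, and recolour each edge by the side at which it starts:
-- the two new factors have the right parities and their degrees differ by at most 2 at every vertex.
-- The sum of all squared degrees decreases, so after finitely many steps any two factors have degrees
-- differing by at most 2 everywhere.

open import Defs
open import Data.Nat hiding (_≟_; parity)
open import Data.Nat.Properties hiding (_≟_; suc-injective)
open import Data.Nat.Divisibility using (_∣_; divides)
open import Data.Nat.Tactic.RingSolver using (solve-∀)
open import Data.Fin using (Fin; zero; suc; _≟_; splitAt; join; _↑ˡ_; _↑ʳ_)
open import Data.Fin.Properties using (any?; all?; suc-injective; splitAt-↑ˡ; splitAt-↑ʳ)
open import Data.Bool using (Bool; true; false; not; _∧_; _∨_; _xor_; if_then_else_; T)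
import Data.Bool as Bool
open import Data.Bool.Properties using (xor-comm; xor-assoc; xor-same; xor-identityʳ; not-involutive; ∧-distribˡ-xor; ∧-zeroʳ; ∧-comm; ∧-identityʳ; ∧-idem; ∨-identityʳ; ∨-zeroʳ; not-¬; ¬-not)
open import Data.Empty using (⊥; ⊥-elim)
open import Data.Unit using (tt)
open import Data.Sum using (_⊎_; inj₁; inj₂; [_,_]′)
open import Data.Product using (Σ; ∃; _×_; _,_; proj₁; proj₂)
open import Function using (_∘_; _$_; case_of_)
open import Relation.Nullary using (¬_; Dec; yes; no; does; contradiction)
open import Relation.Nullary.Decidable using (_×-dec_; _→-dec_; ¬?; map′; dec-true; dec-false)
open import Data.Fin.Subset.Properties using (anySubset?)
open import Data.Vec using (lookup; tabulate)
open import Data.Vec.Properties using (lookup∘tabulate)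
open import Relation.Binary.Definitions using (DecidableEquality)
open import Relation.Binary.PropositionalEquality hiding (J)
open import Data.Product.Properties using (≡-dec)

-- Boolean identities by truth tables

BoolFun : ℕ → Set
BoolFun zero    = Bool
BoolFun (suc n) = Bool → BoolFun n

Valid : ∀ n → BoolFun n → Set
Valid zero    b = T b
Valid (suc n) p = ∀ b → Valid n (p b)

valid : ∀ n → BoolFun n → Bool
valid zero    b = b
valid (suc n) p = valid n (p false) ∧ valid n (p true)

T-∧ˡ : ∀ {x y} → T (x ∧ y) → T x
T-∧ˡ {true} _ = tt

T-∧ʳ : ∀ {x y} → T (x ∧ y) → T y
T-∧ʳ {true} p = p

-- For a concrete `p` the premise `T (valid n p)` evaluates to the unit type, so a caller passes `_`
-- and gets the identity for all arguments without a case split.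
truth-table : ∀ n (p : BoolFun n) → T (valid n p) → Valid n p
truth-table zero    b q = q
truth-table (suc n) p q false = truth-table n (p false) (T-∧ˡ q)
truth-table (suc n) p q true  = truth-table n (p true) (T-∧ʳ {valid n (p false)} q)

infix 4 _==_
_==_ : Bool → Bool → Bool
x == y = not (x xor y)

==⇒≡ : ∀ {x y} → T (x == y) → x ≡ y
==⇒≡ {false} {false} _ = refl
==⇒≡ {true}  {true}  _ = refl

false≢true : ∀ {x : Bool} {A : Set} → x ≡ false → x ≡ true → A
false≢true refl ()

∧-trueˡ : ∀ {x y} → x ∧ y ≡ true → x ≡ true
∧-trueˡ {true} _ = refl

∧-trueʳ : ∀ {x y} → x ∧ y ≡ true → y ≡ true
∧-trueʳ {true} p = p

not-true : ∀ {x} → not x ≡ true → x ≡ false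
not-true {false} _ = refl

does-true : ∀ {A : Set} (d : Dec A) → does d ≡ true → A
does-true (yes a) _ = a

does-sym : ∀ {n} (u v : Fin n) → does (u ≟ v) ≡ does (v ≟ u)
does-sym u v with u ≟ v | v ≟ u
... | yes _ | yes _ = refl
... | yes p | no q  = contradiction (sym p) q
... | no p  | yes q = contradiction (sym q) p
... | no _  | no _  = refl

does-refl : ∀ {n} (u : Fin n) → does (u ≟ u) ≡ true
does-refl u = dec-true (u ≟ u) refl

odd : ℕ → Bool
odd zero    = false
odd (suc n) = not (odd n)

odd-+ : ∀ m n → odd (m + n) ≡ odd m xor odd n
odd-+ zero    n = refl
odd-+ (suc m) n rewrite odd-+ m n with odd m
... | true  = not-involutive _
... | false = refl

odd-b2n : ∀ b → odd (b2n b) ≡ b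
odd-b2n true  = refl
odd-b2n false = refl

odd-b2n* : ∀ b n → odd (b2n b * n) ≡ b ∧ odd n
odd-b2n* true  n = cong odd (+-identityʳ n)
odd-b2n* false n = refl

%2≡odd : ∀ n → n % 2 ≡ b2n (odd n)
%2≡odd zero = refl
%2≡odd (suc zero) = refl
%2≡odd (suc (suc n)) = trans (trans ([m+n]%n≡m%n′ n) (%2≡odd n)) (cong b2n (sym (not-involutive (odd n))))
  where
  open import Data.Nat.DivMod using ([m+n]%n≡m%n)
  [m+n]%n≡m%n′ : ∀ n → suc (suc n) % 2 ≡ n % 2
  [m+n]%n≡m%n′ n = trans (cong (_% 2) (+-comm 2 n)) ([m+n]%n≡m%n n 2)

b2n-injective : ∀ {x y} → b2n x ≡ b2n y → x ≡ y
b2n-injective {true}  {true}  _ = refl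
b2n-injective {false} {false} _ = refl

-- Finite sums and parities

sum-cong : ∀ {m} {g h : Fin m → ℕ} → (∀ i → g i ≡ h i) → sumFin m g ≡ sumFin m h
sum-cong {zero}  p = refl
sum-cong {suc m} p = cong₂ _+_ (p zero) (sum-cong (p ∘ suc))

+-interchange : ∀ a b c d → (a + b) + (c + d) ≡ (a + c) + (b + d)
+-interchange = solve-∀

sum-+ : ∀ {m} (g h : Fin m → ℕ) → sumFin m (λ i → g i + h i) ≡ sumFin m g + sumFin m h
sum-+ {zero}  g h = refl
sum-+ {suc m} g h = trans (cong (g zero + h zero +_) (sum-+ (g ∘ suc) (h ∘ suc)))
                          (+-interchange (g zero) _ _ _)

sum-zero : ∀ {m} {g : Fin m → ℕ} → (∀ i → g i ≡ 0) → sumFin m g ≡ 0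
sum-zero {zero}  p = refl
sum-zero {suc m} p = cong₂ _+_ (p zero) (sum-zero (p ∘ suc))

sum-one : ∀ m → sumFin m (λ _ → 1) ≡ m
sum-one zero    = refl
sum-one (suc m) = cong suc (sum-one m)

sum-mono : ∀ {m} {g h : Fin m → ℕ} → (∀ i → g i ≤ h i) → sumFin m g ≤ sumFin m h
sum-mono {zero}  p = z≤n
sum-mono {suc m} p = +-mono-≤ (p zero) (sum-mono (p ∘ suc))

sum-mono-< : ∀ {m} {g h : Fin m → ℕ} → (∀ i → g i ≤ h i) → ∀ i → g i < h i → sumFin m g < sumFin m h
sum-mono-< {suc m} p zero    q = +-mono-<-≤ q (sum-mono (p ∘ suc))
sum-mono-< {suc m} p (suc i) q = +-mono-≤-< (p zero) (sum-mono-< (p ∘ suc) i q)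

sum-swap : ∀ {m n} (g : Fin m → Fin n → ℕ) →
           sumFin m (λ i → sumFin n (g i)) ≡ sumFin n (λ j → sumFin m (λ i → g i j))
sum-swap {zero}  {n} g = sym (sum-zero {n} (λ _ → refl))
sum-swap {suc m} {n} g = trans (cong (sumFin n (g zero) +_) (sum-swap (g ∘ suc)))
                               (sym (sum-+ (g zero) _))

sum-++ : ∀ m {n} (g : Fin (m + n) → ℕ) →
         sumFin (m + n) g ≡ sumFin m (λ i → g (i ↑ˡ n)) + sumFin n (λ j → g (m ↑ʳ j))
sum-++ zero    g = refl
sum-++ (suc m) g = trans (cong (g zero +_) (sum-++ m (g ∘ suc))) (sym (+-assoc (g zero) _ _))

term≤sum : ∀ {m} (g : Fin m → ℕ) i → g i ≤ sumFin m g
term≤sum {suc m} g zero    = m≤m+n _ _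
term≤sum {suc m} g (suc i) = ≤-trans (term≤sum (g ∘ suc) i) (m≤n+m _ _)

-- The change at `i` is stated additively on both sides, which avoids truncated subtraction.
sum-exchange : ∀ {m} (g h : Fin m → ℕ) i → (∀ j → j ≢ i → g j ≡ h j) →
               sumFin m g + h i ≡ sumFin m h + g i
sum-exchange {suc m} g h zero p =
  trans (cong (λ s → g zero + s + h zero) (sum-cong (λ j → p (suc j) λ ())))
        (swap (g zero) _ (h zero))
  where
  swap : ∀ a s b → a + s + b ≡ b + s + a
  swap = solve-∀
sum-exchange {suc m} g h (suc i) p = begin
  g zero + sumFin m (g ∘ suc) + h (suc i)   ≡⟨ +-assoc (g zero) _ _ ⟩
  g zero + (sumFin m (g ∘ suc) + h (suc i)) ≡⟨ cong₂ _+_ (p zero λ ()) (sum-exchange (g ∘ suc) (h ∘ suc) i λ j q → p (suc j) (q ∘ suc-injective)) ⟩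
  h zero + (sumFin m (h ∘ suc) + g (suc i)) ≡⟨ sym (+-assoc (h zero) _ _) ⟩
  h zero + sumFin m (h ∘ suc) + g (suc i)   ∎
  where open ≡-Reasoning

sum-exchange₂ : ∀ {m} (g h : Fin m → ℕ) {i j} → i ≢ j → (∀ l → l ≢ i → l ≢ j → g l ≡ h l) →
                sumFin m g + (h i + h j) ≡ sumFin m h + (g i + g j)
sum-exchange₂ {m} g h {i} {j} i≢j p = begin
  sumFin m g + (h i + h j)  ≡⟨ sym (+-assoc (sumFin m g) _ _) ⟩
  sumFin m g + h i + h j    ≡⟨ cong (λ z → sumFin m g + z + h j) (sym mid-i) ⟩
  sumFin m g + mid i + h j  ≡⟨ cong (_+ h j) (sum-exchange g mid i λ l q → sym (mid-≢ q)) ⟩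
  sumFin m mid + g i + h j  ≡⟨ +-assoc (sumFin m mid) _ _ ⟩
  sumFin m mid + (g i + h j) ≡⟨ cong (sumFin m mid +_) (+-comm (g i) _) ⟩
  sumFin m mid + (h j + g i) ≡⟨ sym (+-assoc (sumFin m mid) _ _) ⟩
  sumFin m mid + h j + g i  ≡⟨ cong (_+ g i) (sum-exchange mid h j agree) ⟩
  sumFin m h + mid j + g i  ≡⟨ cong (λ z → sumFin m h + z + g i) (mid-≢ (i≢j ∘ sym)) ⟩
  sumFin m h + g j + g i    ≡⟨ +-assoc (sumFin m h) _ _ ⟩
  sumFin m h + (g j + g i)  ≡⟨ cong (sumFin m h +_) (+-comm (g j) _) ⟩
  sumFin m h + (g i + g j)  ∎
  where
  open ≡-Reasoning
  -- An interpolant that has already changed at `i` but not yet at `j`, so that two single exchanges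
  -- suffice.
  mid : Fin m → ℕ
  mid l = if does (l ≟ i) then h l else g l
  mid-i : mid i ≡ h i
  mid-i rewrite does-refl i = refl
  mid-≢ : ∀ {l} → l ≢ i → mid l ≡ g l
  mid-≢ {l} q rewrite dec-false (l ≟ i) q = refl
  agree : ∀ l → l ≢ j → mid l ≡ h l
  agree l q with l ≟ i
  ... | yes _ = refl
  ... | no r  = p l r q

xsum : ∀ m → (Fin m → Bool) → Bool
xsum zero    g = false
xsum (suc m) g = g zero xor xsum m (g ∘ suc)

odd-sum : ∀ {m} (g : Fin m → ℕ) → odd (sumFin m g) ≡ xsum m (odd ∘ g)
odd-sum {zero}  g = refl
odd-sum {suc m} g = trans (odd-+ (g zero) _) (cong (odd (g zero) xor_) (odd-sum (g ∘ suc)))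

xsum-cong : ∀ {m} {g h : Fin m → Bool} → (∀ i → g i ≡ h i) → xsum m g ≡ xsum m h
xsum-cong {zero}  p = refl
xsum-cong {suc m} p = cong₂ _xor_ (p zero) (xsum-cong (p ∘ suc))

xsum≡odd : ∀ {m} (g : Fin m → Bool) → xsum m g ≡ odd (sumFin m (b2n ∘ g))
xsum≡odd g = trans (xsum-cong λ i → sym (odd-b2n (g i))) (sym (odd-sum (b2n ∘ g)))

xsum-false : ∀ {m} {g : Fin m → Bool} → (∀ i → g i ≡ false) → xsum m g ≡ false
xsum-false {zero}  p = refl
xsum-false {suc m} p = cong₂ _xor_ (p zero) (xsum-false (p ∘ suc))

xor-interchange : ∀ a b c d → (a xor b) xor (c xor d) ≡ (a xor c) xor (b xor d)
xor-interchange a b c d =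
  ==⇒≡ (truth-table 4 (λ a b c d → ((a xor b) xor (c xor d)) == ((a xor c) xor (b xor d))) _ a b c d)

xsum-xor : ∀ {m} (g h : Fin m → Bool) → xsum m (λ i → g i xor h i) ≡ xsum m g xor xsum m h
xsum-xor {zero}  g h = refl
xsum-xor {suc m} g h = trans (cong ((g zero xor h zero) xor_) (xsum-xor (g ∘ suc) (h ∘ suc)))
                             (xor-interchange (g zero) _ _ _)

xsum-true : ∀ {m} (g : Fin m → Bool) → xsum m g ≡ true → ∃ λ i → g i ≡ true
xsum-true {suc m} g p with g zero in eq
... | true  = zero , eq
... | false = case xsum-true (g ∘ suc) p of λ { (i , q) → suc i , q }

xsum-exchange₂ : ∀ {m} (g h : Fin m → Bool) {i j} → i ≢ j → (∀ l → l ≢ i → l ≢ j → g l ≡ h l) →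
                 g i xor g j ≡ h i xor h j → xsum m g ≡ xsum m h
xsum-exchange₂ {m} g h {i} {j} i≢j p q = xor-cancelʳ (h i xor h j) _ _ $ begin
  xsum m g xor (h i xor h j)                         ≡⟨ cong (_xor (h i xor h j)) (xsum≡odd g) ⟩
  odd (sumFin m (b2n ∘ g)) xor (h i xor h j)         ≡⟨ odd-exchange g h ⟩
  odd (sumFin m (b2n ∘ g) + (b2n (h i) + b2n (h j))) ≡⟨ cong odd (sum-exchange₂ (b2n ∘ g) (b2n ∘ h) i≢j λ l r s → cong b2n (p l r s)) ⟩
  odd (sumFin m (b2n ∘ h) + (b2n (g i) + b2n (g j))) ≡⟨ sym (odd-exchange h g) ⟩
  odd (sumFin m (b2n ∘ h)) xor (g i xor g j)         ≡⟨ cong₂ _xor_ (sym (xsum≡odd h)) q ⟩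
  xsum m h xor (h i xor h j)                         ∎
  where
  open ≡-Reasoning
  xor-cancelʳ : ∀ z x y → x xor z ≡ y xor z → x ≡ y
  xor-cancelʳ true  true  true  _ = refl
  xor-cancelʳ true  false false _ = refl
  xor-cancelʳ false x y p = trans (sym (xor-identityʳ x)) (trans p (xor-identityʳ y))
  odd-exchange : ∀ (g h : Fin m → Bool) → odd (sumFin m (b2n ∘ g)) xor (h i xor h j) ≡
                                          odd (sumFin m (b2n ∘ g) + (b2n (h i) + b2n (h j)))
  odd-exchange g h = sym (trans (odd-+ (sumFin m (b2n ∘ g)) _)
    (cong (odd (sumFin m (b2n ∘ g)) xor_) (trans (odd-+ (b2n (h i)) _) (cong₂ _xor_ (odd-b2n (h i)) (odd-b2n (h j))))))

-- Vertex sets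

VS : ℕ → Set
VS n = Fin n → Bool

⁅_⁆ : ∀ {n} → Fin n → VS n
⁅ v ⁆ u = does (u ≟ v)

infixr 7 _∩_ _∖_
infixr 6 _∪_ _⊕_
_∩_ _∪_ _∖_ _⊕_ : ∀ {n} → VS n → VS n → VS n
(X ∩ Y) v = X v ∧ Y v
(X ∪ Y) v = X v ∨ Y v
(X ∖ Y) v = X v ∧ not (Y v)
(X ⊕ Y) v = X v xor Y v

∁ : ∀ {n} → VS n → VS n
∁ X v = not (X v)

⊤ₛ : ∀ {n} → VS n
⊤ₛ _ = true

infix 4 _⊆_
_⊆_ : ∀ {n} → VS n → VS n → Set
X ⊆ Y = ∀ v → X v ≡ true → Y v ≡ true

Nonempty : ∀ {n} → VS n → Set
Nonempty X = ∃ λ v → X v ≡ true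

_⊆?_ : ∀ {n} (X Y : VS n) → Dec (X ⊆ Y)
X ⊆? Y = all? λ v → (X v Bool.≟ true) →-dec (Y v Bool.≟ true)

nonempty? : ∀ {n} (X : VS n) → Dec (Nonempty X)
nonempty? X = any? λ v → X v Bool.≟ true

⊆-∨-∖ : ∀ {n} (X Y : VS n) → X ⊆ Y ⊎ Nonempty (X ∖ Y)
⊆-∨-∖ X Y with nonempty? (X ∖ Y)
... | yes p = inj₂ p
... | no ¬p = inj₁ λ v Xv → case Y v Bool.≟ true of λ
  { (yes Yv) → Yv
  ; (no ¬Yv) → contradiction (v , cong₂ _∧_ Xv (cong not (¬-not ¬Yv))) ¬p }

card : ∀ {n} → VS n → ℕ
card {n} X = sumFin n (b2n ∘ X)

b2n-mono : ∀ {x y} → (x ≡ true → y ≡ true) → b2n x ≤ b2n y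
b2n-mono {false} p = z≤n
b2n-mono {true}  p rewrite p refl = ≤-refl

card-< : ∀ {n} {X Y : VS n} → X ⊆ Y → Nonempty (Y ∖ X) → card X < card Y
card-< {X = X} {Y} X⊆Y (v , q) = sum-mono-< (λ u → b2n-mono (X⊆Y u)) v strict
  where
  strict : b2n (X v) < b2n (Y v)
  strict rewrite ∧-trueˡ {Y v} q | not-true (∧-trueʳ {Y v} q) = ≤-refl

Extensional : ∀ {n} {A : Set} → (VS n → A) → Set
Extensional P = ∀ {X Y} → X ≗ Y → P X ≡ P Y

Respects : ∀ {n} → (VS n → Set) → Set
Respects P = ∀ {X Y} → X ≗ Y → P X → P Y

-- The search runs over bit vectors. A set and its tabulation agree only pointwise, which is why `P`
-- must respect `≗`.
anySet? : ∀ {n} {P : VS n → Set} → Respects P → (∀ X → Dec (P X)) → Dec (∃ P)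
anySet? resp P? = map′ (λ { (s , p) → lookup s , p })
                       (λ { (X , p) → tabulate X , resp (λ v → sym (lookup∘tabulate X v)) p })
                       (anySubset? (P? ∘ lookup))

argmin : ∀ {n} {P : VS n → Set} → Respects P → (∀ X → Dec (P X)) → ∃ P →
         ∃ λ Y → P Y × (∀ Z → P Z → card Y ≤ card Z)
argmin {n} {P} resp P? (X , p) = go (card X) X p ≤-refl
  where
  card-cong : Extensional {n} card
  card-cong eq = sum-cong (cong b2n ∘ eq)
  go : ∀ fuel X → P X → card X ≤ fuel → ∃ λ Y → P Y × (∀ Z → P Z → card Y ≤ card Z)
  go fuel X p b with anySet? {P = λ Z → P Z × card Z < card X}
                       (λ { eq (q , l) → resp eq q , subst (_< card X) (card-cong eq) l })
                       (λ Z → P? Z ×-dec (card Z <? card X))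
  ... | no ¬q = X , p , λ Z q → ≮⇒≥ λ l → ¬q (Z , q , l)
  go zero X p b       | yes (Z , q , l) = contradiction (<-≤-trans l b) λ ()
  go (suc fuel) X p b | yes (Z , q , l) = go fuel Z q (≤-pred (<-≤-trans l b))

-- Additive maps from vertex sets (with symmetric difference) to ℤ₂.
record Lin (n : ℕ) : Set where
  field
    ap  : VS n → Bool
    ext : Extensional ap
    add : ∀ X Y → ap (X ⊕ Y) ≡ ap X xor ap Y
open Lin

∅ₛ : ∀ {n} → VS n
∅ₛ _ = false

ap-∅ : ∀ {n} (F : Lin n) {X} → (∀ v → X v ≡ false) → ap F X ≡ false
ap-∅ F {X} p = trans (trans (ext F λ v → trans (p v) (sym (xor-same (X v)))) (add F X X)) (xor-same (ap F X))

-- Additivity determines a functional by its values on singletons. The induction peels off the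
-- vertex `zero` and treats the rest as a functional `F′` on one vertex fewer.
ap-expand : ∀ {n} (F : Lin n) X → ap F X ≡ xsum n (λ v → X v ∧ ap F ⁅ v ⁆)
ap-expand {zero} F X = ap-∅ F λ ()
ap-expand {suc n} F X = begin
  ap F X ≡⟨ ext F split ⟩
  ap F ((λ v → X zero ∧ does (v ≟ zero)) ⊕ tl (X ∘ suc)) ≡⟨ add F _ _ ⟩
  ap F (λ v → X zero ∧ does (v ≟ zero)) xor ap F (tl (X ∘ suc)) ≡⟨ cong₂ _xor_ (head-part (X zero)) (ap-expand F′ (X ∘ suc)) ⟩
  (X zero ∧ ap F ⁅ zero ⁆) xor xsum n (λ v → X (suc v) ∧ ap F (tl ⁅ v ⁆))
    ≡⟨ cong ((X zero ∧ ap F ⁅ zero ⁆) xor_) (xsum-cong λ v → cong (X (suc v) ∧_) (ext F (tl-single v))) ⟩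
  (X zero ∧ ap F ⁅ zero ⁆) xor xsum n (λ v → X (suc v) ∧ ap F ⁅ suc v ⁆) ≡⟨ refl ⟩
  xsum (suc n) (λ v → X v ∧ ap F ⁅ v ⁆) ∎
  where
  open ≡-Reasoning
  tl : VS n → VS (suc n)
  tl Y zero    = false
  tl Y (suc v) = Y v
  F′ : Lin n
  F′ = record
    { ap  = ap F ∘ tl
    ; ext = λ eq → ext F λ { zero → refl ; (suc v) → eq v }
    ; add = λ Y Z → trans (ext F λ { zero → refl ; (suc v) → refl }) (add F (tl Y) (tl Z)) }
  split : X ≗ ((λ v → X zero ∧ does (v ≟ zero)) ⊕ tl (X ∘ suc))
  split zero    with X zero
  ... | true  = refl
  ... | false = refl
  split (suc v) with X zero
  ... | true  = refl
  ... | false = refl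
  head-part : ∀ b → ap F (λ v → b ∧ does (v ≟ zero)) ≡ b ∧ ap F ⁅ zero ⁆
  head-part true  = refl
  head-part false = ap-∅ F λ _ → refl
  tl-single : ∀ v → tl ⁅ v ⁆ ≗ ⁅ suc v ⁆
  tl-single v zero    = refl
  tl-single v (suc u) = refl

pull : ∀ {m n} → (Fin m → Fin n) → Lin m → Lin n
pull π F = record
  { ap  = λ X → ap F (X ∘ π)
  ; ext = λ eq → ext F (eq ∘ π)
  ; add = λ X Y → add F (X ∘ π) (Y ∘ π) }

-- By handshaking this is also the sum of the `J`-degrees over `X` modulo 2. Being an f-parity
-- factor thus becomes the equality of two functionals.
parity : ∀ {m n} → (Fin m → Fin n) → (Fin m → Fin n) → (Fin m → Bool) → VS n → Bool
parity {m} t h J X = xsum m (λ e → J e ∧ (X (t e) xor X (h e)))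

parityLin : ∀ {m n} (t h : Fin m → Fin n) (J : Fin m → Bool) → Lin n
parityLin t h J = record
  { ap  = parity t h J
  ; ext = λ eq → xsum-cong λ e → cong (J e ∧_) (cong₂ _xor_ (eq (t e)) (eq (h e)))
  ; add = λ X Y → trans (xsum-cong λ e → ==⇒≡ (truth-table 5 (λ j a b c d → (j ∧ ((a xor c) xor (b xor d))) == ((j ∧ (a xor b)) xor (j ∧ (c xor d)))) _ (J e) (X (t e)) (X (h e)) (Y (t e)) (Y (h e))))
                        (xsum-xor (λ e → J e ∧ (X (t e) xor X (h e))) _) }

xsum-exchange : ∀ {m} (g h : Fin m → Bool) i → (∀ j → j ≢ i → g j ≡ h j) →
                xsum m g ≡ xsum m h xor (h i xor g i)
xsum-exchange {suc m} g h zero p rewrite xsum-cong {g = g ∘ suc} {h ∘ suc} (λ j → p (suc j) λ ()) =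
  ==⇒≡ (truth-table 3 (λ a b c → (a xor c) == ((b xor c) xor (b xor a))) _ (g zero) (h zero) _)
xsum-exchange {suc m} g h (suc i) p rewrite p zero (λ ())
  | xsum-exchange (g ∘ suc) (h ∘ suc) i (λ j q → p (suc j) (q ∘ suc-injective)) =
  sym (xor-assoc (h zero) _ _)

-- Eulerian orientations

xor-true : ∀ {x y} → x xor y ≡ true → x ≡ true ⊎ y ≡ true
xor-true {true}  _ = inj₁ refl
xor-true {false} p = inj₂ p

-- Replaces the edge i, which joins y to z, by an edge xz; an orientation s of
-- the new graph is pulled back to the path x y z formed by an edge xy and i.
module SplitEdge {V : Set} {m : ℕ} (en : Fin m → Bool → V) (Q : Fin m → Bool) (x : V)
                (i : Fin m) (d : Bool) (Qi : Q i ≡ true) where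

  private
    y z : V
    y = en i d
    z = en i (not d)

  en′ : Fin m → Bool → V
  en′ e b = if does (e ≟ i) ∧ does (b Bool.≟ d) then x else en e b

  private
    en′-≢ : ∀ {e} b → e ≢ i → en′ e b ≡ en e b
    en′-≢ {e} b e≢i rewrite dec-false (e ≟ i) e≢i = refl

    en′-d : en′ i d ≡ x
    en′-d rewrite does-refl i | dec-true (d Bool.≟ d) refl = refl

    en′-¬d : ∀ b → b ≢ d → en′ i b ≡ en i b
    en′-¬d b b≢d rewrite does-refl i | dec-false (b Bool.≟ d) b≢d = refl

    xor-ends : ∀ d (f : Bool → Bool) → f false xor f true ≡ f d xor f (not d)
    xor-ends false f = refl
    xor-ends true  f = xor-comm (f false) _

    wt : (V → ℕ) → (Fin m → Bool → V) → (Fin m → Bool) → Fin m → ℕ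
    wt φ en r e = b2n (Q e) * φ (en e (r e))

    wt-i : ∀ φ en r {v} → en i (r i) ≡ v → wt φ en r i ≡ φ v
    wt-i φ en r p = trans (cong (λ q → b2n q * φ (en i (r i))) Qi) (trans (+-identityʳ _) (cong φ p))

    kept : ∀ φ (r : Fin m → Bool) → r i ≢ d → sumFin m (wt φ en′ r) ≡ sumFin m (wt φ en r)
    kept φ r ri≢d = sum-cong λ e → cong (λ v → b2n (Q e) * φ v) (same e)
      where
      same : ∀ e → en′ e (r e) ≡ en e (r e)
      same e with e ≟ i
      ... | yes refl rewrite dec-false (r i Bool.≟ d) ri≢d = refl
      ... | no _ = refl

    moved : ∀ φ (r : Fin m → Bool) → r i ≡ d →
            sumFin m (wt φ en r) + φ x ≡ sumFin m (wt φ en′ r) + φ y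
    moved φ r ri≡d = subst₂ (λ a b → sumFin m (wt φ en r) + a ≡ sumFin m (wt φ en′ r) + b)
      (wt-i φ en′ r (trans (cong (en′ i) ri≡d) en′-d))
      (wt-i φ en r (cong (en i) ri≡d))
      (sum-exchange (wt φ en r) (wt φ en′ r) i λ e e≢i → cong (λ v → b2n (Q e) * φ v) (sym (en′-≢ (r e) e≢i)))

  split-parity : ∀ (X : V → Bool) →
    xsum m (λ e → Q e ∧ (X (en′ e false) xor X (en′ e true))) ≡
    (X x xor X (en i d)) xor xsum m (λ e → Q e ∧ (X (en e false) xor X (en e true)))
  split-parity X = begin
    xsum m g′                   ≡⟨ xsum-exchange g′ g i (λ e e≢i → cong (Q e ∧_) (cong₂ _xor_ (cong X (en′-≢ false e≢i)) (cong X (en′-≢ true e≢i)))) ⟩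
    xsum m g xor (g i xor g′ i) ≡⟨ cong (xsum m g xor_) (cong₂ _xor_ gi g′i) ⟩
    xsum m g xor ((X y xor X z) xor (X x xor X z))
      ≡⟨ ==⇒≡ (truth-table 4 (λ a b c r → (r xor ((b xor c) xor (a xor c))) == ((a xor b) xor r)) _ (X x) (X y) (X z) (xsum m g)) ⟩
    (X x xor X y) xor xsum m g  ∎
    where
    open ≡-Reasoning
    g g′ : Fin m → Bool
    g e = Q e ∧ (X (en e false) xor X (en e true))
    g′ e = Q e ∧ (X (en′ e false) xor X (en′ e true))
    gi : g i ≡ X y xor X z
    gi = trans (cong (_∧ (X (en i false) xor X (en i true))) Qi) (xor-ends d (X ∘ en i))
    g′i : g′ i ≡ X x xor X z
    g′i = trans (cong (_∧ (X (en′ i false) xor X (en′ i true))) Qi) (trans (xor-ends d (X ∘ en′ i))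
            (cong₂ (λ u v → X u xor X v) en′-d (en′-¬d (not d) (not-¬ refl ∘ sym))))

  -- `b` orients the added edge xy so that it continues the edge `i` through y: it starts at x
  -- exactly when the new edge xz does. Then y gains one arc in and one arc out, and the balance
  -- elsewhere is that of the new graph.
  pull-back : ∀ s → (∀ φ → sumFin m (wt φ en′ s) ≡ sumFin m (wt φ en′ (not ∘ s))) →
    ∃ λ b → ∀ (φ : V → ℕ) → φ (if b then en i d else x) + sumFin m (λ e → b2n (Q e) * φ (en e (s e))) ≡
                  φ (if b then x else en i d) + sumFin m (λ e → b2n (Q e) * φ (en e (not (s e))))
  pull-back s balanced with s i Bool.≟ d
  ... | yes si≡d = false , λ φ → begin
    φ x + sumFin m (wt φ en s)          ≡⟨ +-comm (φ x) (sumFin m (wt φ en s)) ⟩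
    sumFin m (wt φ en s) + φ x          ≡⟨ moved φ s si≡d ⟩
    sumFin m (wt φ en′ s) + φ y         ≡⟨ cong (_+ φ y) (trans (balanced φ) (kept φ (not ∘ s) λ q → not-¬ refl (trans si≡d (sym q)))) ⟩
    sumFin m (wt φ en (not ∘ s)) + φ y  ≡⟨ +-comm (sumFin m (wt φ en (not ∘ s))) (φ y) ⟩
    φ y + sumFin m (wt φ en (not ∘ s))  ∎
    where open ≡-Reasoning
  ... | no si≢d = true , λ φ → begin
    φ y + sumFin m (wt φ en s)          ≡⟨ +-comm (φ y) (sumFin m (wt φ en s)) ⟩
    sumFin m (wt φ en s) + φ y          ≡⟨ cong (_+ φ y) (trans (sym (kept φ s si≢d)) (balanced φ)) ⟩
    sumFin m (wt φ en′ (not ∘ s)) + φ y ≡⟨ sym (moved φ (not ∘ s) (sym (¬-not (si≢d ∘ sym)))) ⟩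
    sumFin m (wt φ en (not ∘ s)) + φ x  ≡⟨ +-comm (sumFin m (wt φ en (not ∘ s))) (φ x) ⟩
    φ x + sumFin m (wt φ en (not ∘ s))  ∎
    where open ≡-Reasoning

-- Induction on the number of edges. Absent edges and loops are oriented arbitrarily; a first edge
-- xy is merged with another edge at y by `SplitEdge`. The balance is claimed for arbitrary weights
-- `φ`, so it survives identifying vertices, and evenness is asked of all predicates on `V`, so `V`
-- need not be finite.
euler : ∀ {V : Set} → DecidableEquality V → ∀ m (ends : Fin m → Bool → V) (Q : Fin m → Bool) →
        (∀ (X : V → Bool) → xsum m (λ e → Q e ∧ (X (ends e false) xor X (ends e true))) ≡ false) →
        ∃ λ (s : Fin m → Bool) → ∀ (φ : V → ℕ) →
          sumFin m (λ e → b2n (Q e) * φ (ends e (s e))) ≡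
          sumFin m (λ e → b2n (Q e) * φ (ends e (not (s e))))
euler _≟ⱽ_ zero    ends Q even = (λ ()) , λ φ → refl
euler {V} _≟ⱽ_ (suc m) ends Q even with Q zero
... | false = (λ { zero → false ; (suc e) → proj₁ rec e }) , proj₂ rec
  where
  rec = euler _≟ⱽ_ m (ends ∘ suc) (Q ∘ suc) even
... | true with ends zero false ≟ⱽ ends zero true
...   | yes loop = (λ { zero → false ; (suc e) → proj₁ rec e }) ,
                   λ φ → cong₂ _+_ (cong (λ v → φ v + 0) loop) (proj₂ rec φ)
  where
  drop-loop : ∀ {a b c} → a ≡ b → (a xor b) xor c ≡ false → c ≡ false
  drop-loop {a} refl p = trans (cong (_xor _) (sym (xor-same a))) p
  rec = euler _≟ⱽ_ m (ends ∘ suc) (Q ∘ suc) λ X → drop-loop (cong X loop) (even X)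
...   | no x≢y = split-at (xsum-true _ rest-odd)
  where
  x y : V
  x = ends zero false
  y = ends zero true
  is-y : V → Bool
  is-y v = does (v ≟ⱽ y)
  odd-rest : ∀ {a b c} → a ≡ false → b ≡ true → (a xor b) xor c ≡ false → c ≡ true
  odd-rest {c = true} refl refl p = refl
  -- The first edge meets the set consisting of y in one end only, so the other edges have odd
  -- degree at y, and one of them can be merged with the first.
  rest-odd : xsum m (λ e → Q (suc e) ∧ (is-y (ends (suc e) false) xor is-y (ends (suc e) true))) ≡ true
  rest-odd = odd-rest (dec-false (x ≟ⱽ y) x≢y) (dec-true (y ≟ⱽ y) refl) (even is-y)
  rest : (V → Bool) → Bool
  rest X = xsum m (λ e → Q (suc e) ∧ (X (ends (suc e) false) xor X (ends (suc e) true)))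
  half : (V → ℕ) → (Fin m → Bool) → ℕ
  half φ s = sumFin m (λ e → b2n (Q (suc e)) * φ (ends (suc e) (s e)))
  Goal : Set
  Goal = ∃ λ (s : Fin (suc m) → Bool) → ∀ (φ : V → ℕ) →
           (φ (ends zero (s zero)) + 0) + half φ (s ∘ suc) ≡
           (φ (ends zero (not (s zero))) + 0) + half φ (not ∘ s ∘ suc)
  split : ∀ i d → Q (suc i) ≡ true → ends (suc i) d ≡ y → Goal
  split i d Qi i-y = (λ { zero → proj₁ back ; (suc e) → proj₁ rec e }) , balanced (proj₁ back) (proj₂ back)
    where
    open SplitEdge (ends ∘ suc) (Q ∘ suc) x i d Qi
    rec = euler _≟ⱽ_ m en′ (Q ∘ suc) λ X →
      trans (split-parity X) (trans (cong (λ v → (X x xor X v) xor rest X) i-y) (even X))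
    back = pull-back (proj₁ rec) (proj₂ rec)
    s = proj₁ rec
    balanced : ∀ b → (∀ (φ : V → ℕ) → φ (if b then ends (suc i) d else x) + half φ s ≡
                                      φ (if b then x else ends (suc i) d) + half φ (not ∘ s)) →
               ∀ (φ : V → ℕ) → (φ (ends zero b) + 0) + half φ s ≡ (φ (ends zero (not b)) + 0) + half φ (not ∘ s)
    balanced false p φ rewrite +-identityʳ (φ x) | +-identityʳ (φ y) =
      subst (λ v → φ x + half φ s ≡ φ v + half φ (not ∘ s)) i-y (p φ)
    balanced true  p φ rewrite +-identityʳ (φ x) | +-identityʳ (φ y) =
      subst (λ v → φ v + half φ s ≡ φ x + half φ (not ∘ s)) i-y (p φ)
  split-at : (∃ λ i → Q (suc i) ∧ (is-y (ends (suc i) false) xor is-y (ends (suc i) true)) ≡ true) → Goal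
  split-at (i , p) = [ (λ q → split i false (∧-trueˡ p) (does-true (_ ≟ⱽ _) q))
                     , (λ q → split i true (∧-trueˡ p) (does-true (_ ≟ⱽ _) q)) ]′ (xor-true (∧-trueʳ {Q (suc i)} p))

-- Functionals supported on a vertex set

xsum-single : ∀ {m} i (g : Fin m → Bool) → xsum m (λ j → does (j ≟ i) ∧ g j) ≡ g i
xsum-single {m} i g = begin
  xsum m (λ j → does (j ≟ i) ∧ g j)   ≡⟨ xsum-exchange _ (λ _ → false) i (λ j q → cong (_∧ g j) (dec-false (j ≟ i) q)) ⟩
  xsum m (λ _ → false) xor (does (i ≟ i) ∧ g i) ≡⟨ cong₂ _xor_ (xsum-false {m} λ _ → refl) (cong (_∧ g i) (does-refl i)) ⟩
  g i ∎
  where open ≡-Reasoning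

Supported : ∀ {n} → Lin n → VS n → Set
Supported F U = ∀ X → (∀ v → U v ≡ true → X v ≡ false) → ap F X ≡ false

ap-agree : ∀ {n} (F : Lin n) {U X Y} → Supported F U → (∀ v → U v ≡ true → X v ≡ Y v) → ap F X ≡ ap F Y
ap-agree F {U} {X} {Y} supp eq = xor-false (trans (sym (add F X Y)) (supp (X ⊕ Y) λ v Uv → trans (cong (_xor Y v) (eq v Uv)) (xor-same (Y v))))
  where
  xor-false : ∀ {x y} → x xor y ≡ false → x ≡ y
  xor-false {true}  {true}  _ = refl
  xor-false {false} {false} _ = refl

ap-scale : ∀ {n} (F : Lin n) b X → ap F (λ v → b ∧ X v) ≡ b ∧ ap F X
ap-scale F true  X = refl
ap-scale F false X = ap-∅ F λ _ → refl

sum-+-≤ : ∀ {m} {a b c d : Fin m → ℕ} → (∀ i → a i + b i ≤ c i + d i) →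
          sumFin m a + sumFin m b ≤ sumFin m c + sumFin m d
sum-+-≤ {m} {a} {b} {c} {d} p = subst₂ _≤_ (sum-+ a b) (sum-+ c d) (sum-mono {m} p)

-- Disjoint branchings

-- The indegree of `X` in the digraph with arc set `S`, tails `t` and heads `h`.
ρ : ∀ {m n} → (Fin m → Fin n) → (Fin m → Fin n) → VS m → VS n → ℕ
ρ {m} t h S X = sumFin m (λ e → b2n (S e ∧ (not (X (t e)) ∧ X (h e))))

module _ {m n} (t h : Fin m → Fin n) where

  ρ-ext : ∀ S → Extensional (ρ t h S)
  ρ-ext S eq = sum-cong λ e → cong b2n (cong₂ (λ x y → S e ∧ (not x ∧ y)) (eq (t e)) (eq (h e)))

  -- The inequality holds for every arc separately, depending only on which of the two sets contain
  -- its ends.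
  ρ-submodular : ∀ S X Y → ρ t h S (X ∩ Y) + ρ t h S (X ∪ Y) ≤ ρ t h S X + ρ t h S Y
  ρ-submodular S X Y = sum-+-≤ {m} λ e → ≤ᵇ⇒≤ _ _ $
    truth-table 5 (λ s a b c d → b2n (s ∧ (not (a ∧ c) ∧ (b ∧ d))) + b2n (s ∧ (not (a ∨ c) ∧ (b ∨ d))) ≤ᵇ
                                 b2n (s ∧ (not a ∧ b)) + b2n (s ∧ (not c ∧ d)))
                _ (S e) (X (t e)) (X (h e)) (Y (t e)) (Y (h e))

  ρ-remove : ∀ S X {e} → S e ≡ true → ρ t h S X ≡ ρ t h (S ∖ ⁅ e ⁆) X + b2n (not (X (t e)) ∧ X (h e))
  ρ-remove S X {e} Se = begin
    sumFin m g          ≡⟨ sym (+-identityʳ _) ⟩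
    sumFin m g + 0      ≡⟨ cong (sumFin m g +_) (sym g′e) ⟩
    sumFin m g + g′ e   ≡⟨ sum-exchange g g′ e (λ f f≢e → cong (λ s → b2n (s ∧ enters f)) (sym (kept f f≢e))) ⟩
    sumFin m g′ + g e   ≡⟨ cong (λ s → sumFin m g′ + b2n (s ∧ enters e)) Se ⟩
    sumFin m g′ + b2n (enters e) ∎
    where
    open ≡-Reasoning
    enters : VS m
    enters f = not (X (t f)) ∧ X (h f)
    g g′ : Fin m → ℕ
    g f = b2n (S f ∧ enters f)
    g′ f = b2n ((S ∖ ⁅ e ⁆) f ∧ enters f)
    kept : ∀ f → f ≢ e → (S ∖ ⁅ e ⁆) f ≡ S f
    kept f f≢e rewrite dec-false (f ≟ e) f≢e with S f
    ... | true  = refl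
    ... | false = refl
    g′e : g′ e ≡ 0
    g′e rewrite does-refl e | Se = refl

hits : ∀ {q n} → (Fin q → Fin n) → VS n → ℕ
hits {q} r X = sumFin q (λ j → b2n (X (r j)))

hits-modular : ∀ {q n} (r : Fin q → Fin n) X Y → hits r (X ∩ Y) + hits r (X ∪ Y) ≡ hits r X + hits r Y
hits-modular {q} r X Y = trans (sym (sum-+ {q} _ _)) (trans (sum-cong {q} λ j → pointwise (X (r j)) (Y (r j))) (sum-+ {q} _ _))
  where
  pointwise : ∀ a b → b2n (a ∧ b) + b2n (a ∨ b) ≡ b2n a + b2n b
  pointwise a b = ≡ᵇ⇒≡ _ _ (truth-table 2 (λ a b → b2n (a ∧ b) + b2n (a ∨ b) ≡ᵇ b2n a + b2n b) _ a b)

hits≤ : ∀ {q n} (r : Fin q → Fin n) X → hits r X ≤ q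
hits≤ {q} r X = ≤-trans (sum-mono λ j → b2n≤1 (X (r j))) (≤-reflexive (sum-one q))
  where
  b2n≤1 : ∀ b → b2n b ≤ 1
  b2n≤1 true  = ≤-refl
  b2n≤1 false = z≤n

Disjoint : ∀ {n} → VS n → VS n → Set
Disjoint X Y = ∀ v → X v ≡ true → Y v ≡ false

module Branchings {m n} (t h : Fin m → Fin n) where

  -- The property of an arborescence E spanning U that is needed here: every
  -- prescription of parities on U with even total is met by a subset of E.
  Joinable : VS m → VS n → Set
  Joinable E U = ∀ (P : Lin n) → Supported P U → ap P U ≡ false →
                 ∃ λ J → J ⊆ E × (∀ X → parity t h J X ≡ ap P X)

  joinable-root : ∀ r → Joinable ∅ₛ ⁅ r ⁆
  joinable-root r P supp P-r = ∅ₛ , (λ _ p → p) , λ X → trans (xsum-false {m} λ _ → refl) (sym (vanishes X))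
    where
    vanishes : ∀ X → ap P X ≡ false
    vanishes X with X r in Xr
    ... | false = supp X λ v v∈r → trans (cong X (does-true (v ≟ r) v∈r)) Xr
    ... | true  = trans (ap-agree P {U = ⁅ r ⁆} supp λ v v∈r → trans (trans (cong X (does-true (v ≟ r) v∈r)) Xr) (sym v∈r)) P-r

  -- The head of `e` is attached as a leaf. Its own demand `c` decides whether `e` is used, and
  -- pulling `P` back along `π`, which sends the leaf to the tail of `e`, passes that demand on to
  -- the tail.
  joinable-extend : ∀ {E U e} → Joinable E U → E e ≡ false → U (t e) ≡ true → U (h e) ≡ false →
                    Joinable (E ∪ ⁅ e ⁆) (U ∪ ⁅ h e ⁆)
  joinable-extend {E} {U} {e} joinable e∉E u∈U v∉U P supp P-U = J′ , J′⊆ , J′-parity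
    where
    u v : Fin n
    u = t e
    v = h e
    π : Fin n → Fin n
    π w = if does (w ≟ v) then u else w
    π-agree : ∀ (X : VS n) → X ⊕ (X ∘ π) ≗ λ w → (X u xor X v) ∧ ⁅ v ⁆ w
    π-agree X w with w ≟ v
    ... | yes refl = trans (xor-comm (X v) (X u)) (sym (∧-identityʳ _))
    ... | no _     = trans (xor-same (X w)) (sym (∧-zeroʳ _))
    supp′ : Supported (pull π P) U
    supp′ X X∩U=∅ = supp (X ∘ π) X∘π∩U=∅
      where
      X∘π∩U=∅ : ∀ w → (U ∪ ⁅ v ⁆) w ≡ true → X (π w) ≡ false
      X∘π∩U=∅ w w∈ with w ≟ v
      ... | yes _ = X∩U=∅ u u∈U
      ... | no _  = X∩U=∅ w (trans (sym (∨-identityʳ _)) w∈)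
    P′-U : ap P (U ∘ π) ≡ false
    P′-U = trans (ext P U∘π) P-U
      where
      U∘π : U ∘ π ≗ U ∪ ⁅ v ⁆
      U∘π w with w ≟ v
      ... | yes _ = trans u∈U (sym (∨-zeroʳ (U w)))
      ... | no _  = sym (∨-identityʳ _)
    rec = joinable (pull π P) supp′ P′-U
    J = proj₁ rec
    c = ap P ⁅ v ⁆
    J′ : VS m
    J′ f = J f xor (does (f ≟ e) ∧ c)
    J′⊆ : J′ ⊆ E ∪ ⁅ e ⁆
    J′⊆ f p with f ≟ e
    ... | yes _ = ∨-zeroʳ _
    ... | no _  = trans (∨-identityʳ _) (proj₁ (proj₂ rec) f (trans (sym (xor-identityʳ _)) p))
    J′-parity : ∀ X → parity t h J′ X ≡ ap P X
    J′-parity X = begin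
      parity t h J′ X
        ≡⟨ xsum-cong (λ f → ==⇒≡ (truth-table 4 (λ j i c z → ((j xor (i ∧ c)) ∧ z) == ((j ∧ z) xor (i ∧ (c ∧ z)))) _ (J f) (does (f ≟ e)) c (X (t f) xor X (h f)))) ⟩
      xsum m (λ f → (J f ∧ (X (t f) xor X (h f))) xor (does (f ≟ e) ∧ (c ∧ (X (t f) xor X (h f)))))
        ≡⟨ xsum-xor (λ f → J f ∧ (X (t f) xor X (h f))) _ ⟩
      parity t h J X xor xsum m (λ f → does (f ≟ e) ∧ (c ∧ (X (t f) xor X (h f))))
        ≡⟨ cong₂ _xor_ (proj₂ (proj₂ rec) X) (xsum-single e λ f → c ∧ (X (t f) xor X (h f))) ⟩
      ap P (X ∘ π) xor (c ∧ (X u xor X v))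
        ≡⟨ cong (ap P (X ∘ π) xor_) (trans (∧-comm c _) (sym (trans (ext P (π-agree X)) (ap-scale P (X u xor X v) ⁅ v ⁆)))) ⟩
      ap P (X ∘ π) xor ap P (X ⊕ (X ∘ π)) ≡⟨ cong (ap P (X ∘ π) xor_) (add P X (X ∘ π)) ⟩
      ap P (X ∘ π) xor (ap P X xor ap P (X ∘ π))
        ≡⟨ ==⇒≡ (truth-table 2 (λ a b → (a xor (b xor a)) == b) _ (ap P (X ∘ π)) (ap P X)) ⟩
      ap P X ∎
      where open ≡-Reasoning

  module _ (A : VS n) where

    Inside : VS m → Set
    Inside S = ∀ e → S e ≡ true → A (t e) ≡ true × A (h e) ≡ true

    -- S together with one arc from a new root to each r j enters every set B at least q times.
    Enough : ∀ {q′} → ℕ → (Fin q′ → Fin n) → VS m → VS n → Set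
    Enough q r S B = q ≤ ρ t h S B + hits r B

    module Grow {q} (r : Fin q → Fin n) (S₀ : VS m) where

      -- `E` is the arborescence grown so far on `U`, and `S` holds the arcs left for the other `q`
      -- ones. A set disjoint from `U` must keep one unit more, because the finished arborescence
      -- still has to enter it.
      record Partial (U : VS n) (S E : VS m) : Set where
        field
          U⊆A      : U ⊆ A
          S⊆S₀     : S ⊆ S₀
          E⊆S₀     : E ⊆ S₀
          E∩S=∅    : Disjoint E S
          inside   : Inside S
          joinable : Joinable E U
          outside-U : ∀ B → B ⊆ A → Nonempty B → Disjoint U B → Enough (suc q) r S B
          enough   : ∀ B → B ⊆ A → Nonempty B → Enough q r S B

      module Step {U S E} (partial : Partial U S E) (rest : Nonempty (A ∖ U)) where
        open Partial partial

        -- Lovász: an arc inside a minimal tight set that is not contained in U can be added.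
        Tight : VS n → Set
        Tight Z = Z ⊆ A × Nonempty (Z ∖ U) × ρ t h S Z + hits r Z ≤ q

        tight? : ∀ Z → Dec (Tight Z)
        tight? Z = (Z ⊆? A) ×-dec (nonempty? (Z ∖ U) ×-dec (ρ t h S Z + hits r Z ≤? q))

        tight-resp : Respects Tight
        tight-resp eq (p , (v , w) , l) =
          (λ v Yv → p v (trans (eq v) Yv)) ,
          (v , trans (cong (_∧ not (U v)) (sym (eq v))) w) ,
          subst (_≤ q) (cong₂ _+_ (ρ-ext t h S eq) (sum-cong λ j → cong b2n (eq (r j)))) l

        -- The remaining arcs lie inside `A`, so none enters it, and only `q` roots can hit it. This
        -- starts the search for a minimal tight set.
        A-tight : Tight A
        A-tight = (λ _ p → p) , rest , subst (λ z → z + hits r A ≤ q) (sym (sum-zero no-arc)) (hits≤ r A)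
          where
          no-arc : ∀ e → b2n (S e ∧ (not (A (t e)) ∧ A (h e))) ≡ 0
          no-arc e with S e in Se
          ... | false = refl
          ... | true rewrite proj₁ (inside e Se) = refl

        minimal = argmin tight-resp tight? (A , A-tight)
        Z = proj₁ minimal

        tight-Z : Tight Z
        tight-Z = proj₁ (proj₂ minimal)

        new : VS m
        new e = S e ∧ ((Z (t e) ∧ U (t e)) ∧ (Z (h e) ∧ not (U (h e))))

        -- `Z ∖ U` avoids `U` and so needs `suc q` arcs and roots, whereas `Z` has at most `q`. Some
        -- arc therefore enters `Z ∖ U` from `Z ∩ U`.
        new-arc : ∃ λ e → new e ≡ true
        new-arc with any? (λ e → new e Bool.≟ true)
        ... | yes p = p
        ... | no ¬p = contradiction bound (<⇒≱ ≤-refl)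
          where
          pointwise : ∀ e → b2n (S e ∧ (not ((Z ∖ U) (t e)) ∧ (Z ∖ U) (h e))) ≤ b2n (S e ∧ (not (Z (t e)) ∧ Z (h e)))
          pointwise e = ≤-trans
            (≤ᵇ⇒≤ _ _ (truth-table 5 (λ s a b c d → b2n (s ∧ (not (a ∧ not b) ∧ (c ∧ not d))) ≤ᵇ
                                       b2n (s ∧ (not a ∧ c)) + b2n (s ∧ ((a ∧ b) ∧ (c ∧ not d)))) _
                                     (S e) (Z (t e)) (U (t e)) (Z (h e)) (U (h e))))
            (≤-reflexive (trans (cong (λ b → b2n (S e ∧ (not (Z (t e)) ∧ Z (h e))) + b2n b) (¬-not λ p → ¬p (e , p))) (+-identityʳ _)))
          bound : suc q ≤ q
          bound = ≤-trans (outside-U (Z ∖ U) (λ v p → proj₁ tight-Z v (∧-trueˡ p)) (proj₁ (proj₂ tight-Z))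
                            (λ v Uv → trans (cong (λ b → Z v ∧ not b) Uv) (∧-zeroʳ (Z v))))
                 (≤-trans (+-mono-≤ (sum-mono pointwise) (sum-mono λ j → b2n-mono {Z (r j) ∧ not (U (r j))} ∧-trueˡ))
                          (proj₂ (proj₂ tight-Z)))

        e = proj₁ new-arc
        u v : Fin n
        u = t e
        v = h e
        Se : S e ≡ true
        Se = ∧-trueˡ (proj₂ new-arc)
        Zu : Z u ≡ true
        Zu = ∧-trueˡ (∧-trueˡ (∧-trueʳ {S e} (proj₂ new-arc)))
        Uu : U u ≡ true
        Uu = ∧-trueʳ {Z u} (∧-trueˡ (∧-trueʳ {S e} (proj₂ new-arc)))
        v∈Z∖U : (Z ∖ U) v ≡ true
        v∈Z∖U = ∧-trueʳ {Z u ∧ U u} (∧-trueʳ {S e} (proj₂ new-arc))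

        -- If `B` had only `q`, uncrossing with `Z` would make `Z ∩ B` tight: it contains v, which
        -- is outside `U`. It misses u, which is in `Z`, so it would contradict the minimality of
        -- `Z`.
        not-tight : ∀ B → B ⊆ A → B v ≡ true → B u ≡ false → Enough (suc q) r S B
        not-tight B B⊆A Bv Bu = ≰⇒> λ B-tight → <⇒≱ smaller (proj₂ (proj₂ minimal) (Z ∩ B) (Z∩B-tight B-tight))
          where
          smaller : card (Z ∩ B) < card Z
          smaller = card-< (λ w → ∧-trueˡ) (u , cong₂ (λ a b → a ∧ not (a ∧ b)) Zu Bu)
          Z∪B⊆A : Z ∪ B ⊆ A
          Z∪B⊆A w p with Z w in Zw
          ... | true  = proj₁ tight-Z w Zw
          ... | false = B⊆A w p
          uncross : (ρ t h S (Z ∩ B) + hits r (Z ∩ B)) + (ρ t h S (Z ∪ B) + hits r (Z ∪ B)) ≤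
                    (ρ t h S Z + hits r Z) + (ρ t h S B + hits r B)
          uncross = subst₂ _≤_ (+-interchange (ρ t h S (Z ∩ B)) _ _ _) (+-interchange (ρ t h S Z) _ _ _)
                      (+-mono-≤ (ρ-submodular t h S Z B) (≤-reflexive (hits-modular r Z B)))
          Z∩B-tight : ρ t h S B + hits r B ≤ q → Tight (Z ∩ B)
          Z∩B-tight B-tight = (λ w p → proj₁ tight-Z w (∧-trueˡ p)) ,
            (v , trans (cong (λ b → (Z v ∧ b) ∧ not (U v)) Bv) (trans (cong (_∧ not (U v)) (∧-identityʳ (Z v))) v∈Z∖U)) ,
            +-cancelʳ-≤ q _ _ (≤-trans (+-monoʳ-≤ (ρ t h S (Z ∩ B) + hits r (Z ∩ B)) (enough (Z ∪ B) Z∪B⊆A (v , cong (_∨ B v) (∧-trueˡ v∈Z∖U))))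
                              (≤-trans uncross (+-mono-≤ (proj₂ (proj₂ tight-Z)) B-tight)))

        S′ E′ : VS m
        S′ = S ∖ ⁅ e ⁆
        E′ = E ∪ ⁅ e ⁆
        U′ : VS n
        U′ = U ∪ ⁅ v ⁆

        unaffected : ∀ B → (not (B u) ∧ B v) ≡ false → ρ t h S B ≡ ρ t h S′ B
        unaffected B p = trans (ρ-remove t h S B Se) (trans (cong (λ b → ρ t h S′ B + b2n b) p) (+-identityʳ _))

        ∪-elim : ∀ {k} (X : VS k) {x w} → (X ∪ ⁅ x ⁆) w ≡ true → X w ≡ true ⊎ w ≡ x
        ∪-elim X {x} {w} p with X w
        ... | true  = inj₁ refl
        ... | false = inj₂ (does-true (w ≟ x) p)

        next : Partial U′ S′ E′
        next = record
          { U⊆A      = λ w p → case ∪-elim U p of λ { (inj₁ q) → U⊆A w q ; (inj₂ refl) → proj₂ (inside e Se) }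
          ; S⊆S₀     = λ f p → S⊆S₀ f (∧-trueˡ p)
          ; E⊆S₀     = λ f p → case ∪-elim E p of λ { (inj₁ q) → E⊆S₀ f q ; (inj₂ refl) → S⊆S₀ e Se }
          ; E∩S=∅    = λ f p → case ∪-elim E p of λ
              { (inj₁ q)    → cong (_∧ not (does (f ≟ e))) (E∩S=∅ f q)
              ; (inj₂ refl) → trans (cong (λ b → S e ∧ not b) (does-refl e)) (∧-zeroʳ (S e)) }
          ; inside   = λ f p → inside f (∧-trueˡ p)
          ; joinable = joinable-extend joinable e∉E Uu (not-true (∧-trueʳ {Z v} v∈Z∖U))
          -- The head v of the moved arc is now in `U′`, so `B` avoids v and the arc did not enter
          -- `B`.
          ; outside-U = λ B B⊆A B≠∅ U′∩B=∅ →
              subst (λ z → suc q ≤ z + hits r B)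
                (unaffected B (trans (cong (not (B u) ∧_) (U′∩B=∅ v (trans (cong (U v ∨_) (does-refl v)) (∨-zeroʳ (U v))))) (∧-zeroʳ _)))
                (outside-U B B⊆A B≠∅ λ w Uw → U′∩B=∅ w (cong (_∨ does (w ≟ v)) Uw))
          ; enough   = enough′ }
          where
          e∉E : E e ≡ false
          e∉E with E e in Ee
          ... | false = refl
          ... | true  = trans (sym Se) (E∩S=∅ e Ee)
          enough′ : ∀ B → B ⊆ A → Nonempty B → Enough q r S′ B
          enough′ B B⊆A B≠∅ with B u in Bu | B v in Bv
          -- Only here does `e` enter `B`, which thereby loses one; `not-tight` provides the spare
          -- unit.
          ... | false | true = ≤-pred (subst (suc q ≤_) one-less (not-tight B B⊆A Bv Bu))
            where
            one-less : ρ t h S B + hits r B ≡ suc (ρ t h S′ B + hits r B)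
            one-less = cong (_+ hits r B) (trans (ρ-remove t h S B Se)
              (trans (cong (λ b → ρ t h S′ B + b2n b) (cong₂ (λ a b → not a ∧ b) Bu Bv)) (+-comm _ 1)))
          ... | true  | _     = subst (λ z → q ≤ z + hits r B) (unaffected B (cong (λ a → not a ∧ B v) Bu)) (enough B B⊆A B≠∅)
          ... | false | false = subst (λ z → q ≤ z + hits r B) (unaffected B (trans (cong (not (B u) ∧_) Bv) (∧-zeroʳ _))) (enough B B⊆A B≠∅)

        fewer-left : card (A ∖ U′) < card (A ∖ U)
        fewer-left = card-< (λ w p → sub (A w) (U w) _ p) (v , v-left)
          where
          sub : ∀ a b c → a ∧ not (b ∨ c) ≡ true → a ∧ not b ≡ true
          sub true false _ _ = refl
          v-left : ((A ∖ U) ∖ (A ∖ U′)) v ≡ true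
          v-left rewrite proj₂ (inside e Se) | not-true (∧-trueʳ {Z v} v∈Z∖U) | does-refl v = refl

      complete : ∀ fuel {U S E} → card (A ∖ U) ≤ fuel → Partial U S E → ∃ λ S → ∃ λ E → Partial A S E
      complete fuel {U} {S} {E} b partial with ⊆-∨-∖ A U
      ... | inj₁ A⊆U = S , E , record
        { U⊆A       = λ _ p → p
        ; S⊆S₀      = S⊆S₀
        ; E⊆S₀      = E⊆S₀
        ; E∩S=∅     = E∩S=∅
        ; inside    = inside
        ; enough    = enough
        ; joinable  = λ P supp P-A → joinable P
            (λ X p → supp X λ v Av → p v (A⊆U v Av))
            (trans (ext P λ v → iff (U⊆A v) (A⊆U v)) P-A)
        ; outside-U = λ B B⊆A B≠∅ A∩B=∅ → outside-U B B⊆A B≠∅ λ v Uv → A∩B=∅ v (U⊆A v Uv) }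
        where
        open Partial partial
        iff : ∀ {a b} → (a ≡ true → b ≡ true) → (b ≡ true → a ≡ true) → a ≡ b
        iff {true}  p q = sym (p refl)
        iff {false} {false} p q = refl
        iff {false} {true}  p q = q refl
      complete zero    b partial | inj₂ rest = contradiction (<-≤-trans (Step.fewer-left partial rest) b) λ ()
      complete (suc k) b partial | inj₂ rest =
        complete k (≤-pred (<-≤-trans (Step.fewer-left partial rest) b)) (Step.next partial rest)

    -- The arborescences are split off one root at a time, and each is used at once to realise its
    -- prescribed parities. Only the resulting edge sets are returned, since nothing else about the
    -- arborescences is needed later.
    edmonds : ∀ q (r : Fin q → Fin n) S → (∀ j → A (r j) ≡ true) → Inside S →
              (∀ B → B ⊆ A → Nonempty B → Enough q r S B) →
              (P : Fin q → Lin n) → (∀ i → Supported (P i) A) → (∀ i → ap (P i) A ≡ false) →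
              ∃ λ (J : Fin q → VS m) → (∀ i → J i ⊆ S) ×
                (∀ i j e → J i e ≡ true → J j e ≡ true → i ≡ j) ×
                (∀ i X → parity t h (J i) X ≡ ap (P i) X)
    edmonds zero    r S r∈A inside enough P supp P-A = (λ ()) , (λ ()) , (λ ()) , (λ ())
    edmonds (suc q) r S r∈A inside enough P supp P-A = J , J⊆S , disjoint , J-parity
      where
      module G = Grow (r ∘ suc) S
      start : G.Partial ⁅ r zero ⁆ S ∅ₛ
      start = record
        { U⊆A       = λ v p → trans (cong A (does-true (v ≟ r zero) p)) (r∈A zero)
        ; S⊆S₀      = λ _ p → p
        ; E⊆S₀      = λ _ ()
        ; E∩S=∅     = λ _ ()
        ; inside    = inside
        ; joinable  = joinable-root (r zero)
        -- A set that avoids the first root is not hit by it, so it keeps the full bound `suc q`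
        -- after this root is dropped; any other set loses at most one.
        ; outside-U = λ B B⊆A B≠∅ d → subst (λ b → suc q ≤ ρ t h S B + (b2n b + hits (r ∘ suc) B))
                                           (d (r zero) (does-refl (r zero))) (enough B B⊆A B≠∅)
        ; enough    = λ B B⊆A B≠∅ → drop (B (r zero)) (ρ t h S B) (enough B B⊆A B≠∅) }
        where
        drop : ∀ b x {y} → suc q ≤ x + (b2n b + y) → q ≤ x + y
        drop true  x {y} p = ≤-pred (subst (suc q ≤_) (+-suc x y) p)
        drop false x p = ≤-trans (n≤1+n q) p
      grown = G.complete (card (A ∖ ⁅ r zero ⁆)) ≤-refl start
      S₁ = proj₁ grown
      E = proj₁ (proj₂ grown)
      open G.Partial (proj₂ (proj₂ grown)) renaming (inside to inside₁; enough to enough₁)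
      first = joinable (P zero) (supp zero) (P-A zero)
      rest = edmonds q (r ∘ suc) S₁ (r∈A ∘ suc) inside₁ enough₁ (P ∘ suc) (supp ∘ suc) (P-A ∘ suc)
      J : Fin (suc q) → VS m
      J zero    = proj₁ first
      J (suc i) = proj₁ rest i
      J⊆S : ∀ i → J i ⊆ S
      J⊆S zero    e p = E⊆S₀ e (proj₁ (proj₂ first) e p)
      J⊆S (suc i) e p = S⊆S₀ e (proj₁ (proj₂ rest) i e p)
      clash : ∀ i e → J zero e ≡ true → J (suc i) e ≡ true → ⊥
      clash i e p q = false≢true (E∩S=∅ e (proj₁ (proj₂ first) e p)) (proj₁ (proj₂ rest) i e q)
      disjoint : ∀ i j e → J i e ≡ true → J j e ≡ true → i ≡ j
      disjoint zero    zero    e p q = refl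
      disjoint zero    (suc j) e p q = ⊥-elim (clash j e p q)
      disjoint (suc i) zero    e p q = ⊥-elim (clash i e q p)
      disjoint (suc i) (suc j) e p q = cong suc (proj₁ (proj₂ (proj₂ rest)) i j e p q)
      J-parity : ∀ i X → parity t h (J i) X ≡ ap (P i) X
      J-parity zero    = proj₂ (proj₂ first)
      J-parity (suc i) = proj₂ (proj₂ (proj₂ rest)) i

sum-+-< : ∀ {m} {a b c d : Fin m → ℕ} → (∀ i → a i + b i ≤ c i + d i) → ∀ i → a i + b i < c i + d i →
          sumFin m a + sumFin m b < sumFin m c + sumFin m d
sum-+-< {m} {a} {b} {c} {d} p i q = subst₂ _<_ (sum-+ a b) (sum-+ c d) (sum-mono-< {m} p i q)

sum-positive : ∀ {m} (g : Fin m → Bool) → 0 < sumFin m (b2n ∘ g) → ∃ λ i → g i ≡ true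
sum-positive {m} g p with any? (λ i → g i Bool.≟ true)
... | yes q = q
... | no ¬q = contradiction (subst (0 <_) (sum-zero {m} λ i → cong b2n (¬-not λ r → ¬q (i , r))) p) λ ()

sum-zero⁻ : ∀ {m} (g : Fin m → Bool) → sumFin m (b2n ∘ g) ≡ 0 → ∀ i → g i ≡ false
sum-zero⁻ g p i with g i | subst (b2n (g i) ≤_) p (term≤sum (b2n ∘ g) i)
... | false | _ = refl

ap-∁ : ∀ {n} (F : Lin n) → ap F ⊤ₛ ≡ false → ∀ X → ap F (∁ X) ≡ ap F X
ap-∁ F F⊤ X = trans (add F ⊤ₛ X) (cong (_xor ap F X) F⊤)

ap-∪ : ∀ {n} (F : Lin n) X Y → ap F (X ∪ Y) ≡ ap F X xor (ap F Y xor ap F (X ∩ Y))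
ap-∪ F X Y = trans (ext F λ v → ==⇒≡ (truth-table 2 (λ a b → (a ∨ b) == (a xor (b xor (a ∧ b)))) _ (X v) (Y v)))
                   (trans (add F X _) (cong (ap F X xor_) (add F Y _)))

ap-∖ : ∀ {n} (F : Lin n) X Y → ap F (X ∖ Y) ≡ ap F X xor ap F (X ∩ Y)
ap-∖ F X Y = trans (ext F λ v → ==⇒≡ (truth-table 2 (λ a b → (a ∧ not b) == (a xor (a ∧ b))) _ (X v) (Y v)))
                   (add F X _)

-- Splitting off and contraction

-- When `i` enters a vertex and `j` leaves it, exchanging their heads splits the pair off: `i`
-- bypasses the vertex and `j` becomes a loop there. The arcs keep their index set.
swap : ∀ {m} {A : Set} → (Fin m → A) → Fin m → Fin m → Fin m → A
swap h i j f = if does (f ≟ i) then h j else if does (f ≟ j) then h i else h f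

module _ {m} {A : Set} (h : Fin m → A) {i j : Fin m} where

  swap-i : swap h i j i ≡ h j
  swap-i rewrite does-refl i = refl

  swap-j : i ≢ j → swap h i j j ≡ h i
  swap-j i≢j rewrite dec-false (j ≟ i) (i≢j ∘ sym) | does-refl j = refl

  swap-other : ∀ f → f ≢ i → f ≢ j → swap h i j f ≡ h f
  swap-other f f≢i f≢j rewrite dec-false (f ≟ i) f≢i | dec-false (f ≟ j) f≢j = refl

module _ {m n} (t h : Fin m → Fin n) where

  -- The Eulerian condition. Indicator weights give equal indegrees and outdegrees; arbitrary
  -- weights let it pass to a contraction by composing `φ` with the contraction map.
  Balanced : Set
  Balanced = ∀ (φ : Fin n → ℕ) → sumFin m (φ ∘ t) ≡ sumFin m (φ ∘ h)

  LargeCuts : ℕ → Lin n → Set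
  LargeCuts q F = ∀ X → ap F X ≡ true → q ≤ ρ t h ⊤ₛ X

  Packing : ℕ → Lin n → Set
  Packing q F = ∃ λ (J : Fin q → VS m) → (∀ i j e → J i e ≡ true → J j e ≡ true → i ≡ j) ×
                  (∀ i X → parity t h (J i) X ≡ ap F X)

  -- For each arc, having its head in `X` plus leaving `X` equals having its tail in `X` plus
  -- entering `X`. Summed over all arcs, the first terms on both sides cancel by balance.
  balanced-∁ : Balanced → ∀ X → ρ t h ⊤ₛ (∁ X) ≡ ρ t h ⊤ₛ X
  balanced-∁ bal X = +-cancelˡ-≡ (sumFin m (b2n ∘ X ∘ h)) _ _ $ begin
    sumFin m (b2n ∘ X ∘ h) + ρ t h ⊤ₛ (∁ X)  ≡⟨ sym (sum-+ {m} _ _) ⟩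
    sumFin m (λ e → b2n (X (h e)) + b2n (not (not (X (t e))) ∧ not (X (h e))))
      ≡⟨ sum-cong {m} (λ e → ≡ᵇ⇒≡ _ _ (truth-table 2 (λ a b → b2n b + b2n (not (not a) ∧ not b) ≡ᵇ b2n a + b2n (not a ∧ b)) _ (X (t e)) (X (h e)))) ⟩
    sumFin m (λ e → b2n (X (t e)) + b2n (not (X (t e)) ∧ X (h e))) ≡⟨ sum-+ {m} _ _ ⟩
    sumFin m (b2n ∘ X ∘ t) + ρ t h ⊤ₛ X      ≡⟨ cong (_+ ρ t h ⊤ₛ X) (bal (b2n ∘ X)) ⟩
    sumFin m (b2n ∘ X ∘ h) + ρ t h ⊤ₛ X      ∎
    where open ≡-Reasoning

-- Lovász's splitting argument at x for a fixed arc `e₁` from u to x. If no arc leaving x could be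
-- split off with `e₁`, a minimal tight set containing x but not u would lead to a contradiction.
module SplitArc {m n q} (t h : Fin m → Fin n) (F : Lin n) (bal : Balanced t h) (cuts : LargeCuts t h q F)
                (F⊤ : ap F ⊤ₛ ≡ false) {x : Fin n} (Fx : ap F ⁅ x ⁆ ≡ false)
                {e₁ : Fin m} (h₁ : h e₁ ≡ x) (t₁ : t e₁ ≢ x) where

  u : Fin n
  u = t e₁

  Leaves : Fin m → Set
  Leaves e = t e ≡ x × h e ≢ x

  leaves⇒≢ : ∀ {e} → Leaves e → e₁ ≢ e
  leaves⇒≢ (te , _) refl = t₁ te

  swap-balanced : ∀ {e₂} → Leaves e₂ → Balanced t (swap h e₁ e₂)
  swap-balanced {e₂} l φ = trans (bal φ) (+-cancelʳ-≡ (φ (h e₁) + φ (h e₂)) _ _ (trans (cong (sumFin m (φ ∘ h) +_) (sym ends-eq)) exchange))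
    where
    e₁≢e₂ = leaves⇒≢ l
    h′ = swap h e₁ e₂
    exchange = sum-exchange₂ (φ ∘ h) (φ ∘ h′) e₁≢e₂ λ f p q → cong φ (sym (swap-other h f p q))
    ends-eq : φ (h′ e₁) + φ (h′ e₂) ≡ φ (h e₁) + φ (h e₂)
    ends-eq = trans (cong₂ _+_ (cong φ (swap-i h {e₁} {e₂})) (cong φ (swap-j h e₁≢e₂))) (+-comm (φ (h e₂)) _)

  swap-ρ : ∀ {e₂} → Leaves e₂ → ∀ X →
           ρ t h ⊤ₛ X + (b2n (not (X u) ∧ X (h e₂)) + b2n (not (X x) ∧ X x)) ≡
           ρ t (swap h e₁ e₂) ⊤ₛ X + (b2n (not (X u) ∧ X x) + b2n (not (X x) ∧ X (h e₂)))
  swap-ρ {e₂} l X = subst₂ (λ a b → ρ t h ⊤ₛ X + a ≡ ρ t h′ ⊤ₛ X + b) after before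
    (sum-exchange₂ (λ f → b2n (not (X (t f)) ∧ X (h f))) (λ f → b2n (not (X (t f)) ∧ X (h′ f))) e₁≢e₂
      λ f p q → cong (λ w → b2n (not (X (t f)) ∧ X w)) (sym (swap-other h f p q)))
    where
    e₁≢e₂ = leaves⇒≢ l
    h′ = swap h e₁ e₂
    arc : Fin n → Fin n → ℕ
    arc v w = b2n (not (X v) ∧ X w)
    after : arc u (h′ e₁) + arc (t e₂) (h′ e₂) ≡ arc u (h e₂) + arc x x
    after = cong₂ _+_ (cong (arc u) (swap-i h {e₁} {e₂})) (cong₂ arc (proj₁ l) (trans (swap-j h e₁≢e₂) h₁))
    before : arc u (h e₁) + arc (t e₂) (h e₂) ≡ arc u x + arc x (h e₂)
    before = cong₂ _+_ (cong (arc u) h₁) (cong (λ v → arc v (h e₂)) (proj₁ l))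

  Tight : VS n → Set
  Tight Y = ap F Y ≡ true × ρ t h ⊤ₛ Y ≤ q × Y x ≡ true × Y u ≡ false

  tight-resp : Respects Tight
  tight-resp eq (a , b , c , d) =
    trans (sym (ext F eq)) a , subst (_≤ q) (ρ-ext t h ⊤ₛ eq) b , trans (sym (eq x)) c , trans (sym (eq u)) d

  tight? : ∀ Y → Dec (Tight Y)
  tight? Y = (ap F Y Bool.≟ true) ×-dec ((ρ t h ⊤ₛ Y ≤? q) ×-dec ((Y x Bool.≟ true) ×-dec (Y u Bool.≟ false)))

  Bad : Fin m → Set
  Bad e₂ = ∃ λ X → ap F X ≡ true × ρ t (swap h e₁ e₂) ⊤ₛ X < q

  bad? : ∀ e₂ → Dec (Bad e₂)
  bad? e₂ = anySet? (λ { eq (a , b) → trans (sym (ext F eq)) a , subst (_< q) (ρ-ext t (swap h e₁ e₂) ⊤ₛ eq) b })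
                    (λ X → (ap F X Bool.≟ true) ×-dec (ρ t (swap h e₁ e₂) ⊤ₛ X <? q))

  -- Passing to the complement if necessary, `X` contains x. Splitting then lowers its indegree only
  -- if `X` avoids both u and the head of `e₂`, and in that case by exactly one.
  bad⇒tight : ∀ {e₂} → Leaves e₂ → Bad e₂ → ∃ λ Y → Tight Y × Y (h e₂) ≡ false
  bad⇒tight {e₂} l (X , FX , small) = case X x Bool.≟ true of λ
    { (yes Xx) → X , containing-x X Xx FX small
    ; (no ¬Xx) → ∁ X , containing-x (∁ X) (cong not (¬-not ¬Xx)) (trans (ap-∁ F F⊤ X) FX)
                         (subst (_< q) (sym (balanced-∁ t (swap h e₁ e₂) (swap-balanced l) X)) small) }
    where
    containing-x : ∀ X → X x ≡ true → ap F X ≡ true → ρ t (swap h e₁ e₂) ⊤ₛ X < q → Tight X × X (h e₂) ≡ false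
    containing-x X Xx FX small with X u in Xu | X (h e₂) in Xv | swap-ρ l X
    ... | false | false | p rewrite Xx =
          (FX , subst (_≤ q) (trans (sym (trans p (+-comm _ 1))) (+-identityʳ _)) small , refl , refl) , refl
    ... | false | true  | p rewrite Xx = contradiction (cuts X FX) (<⇒≱ (subst (_< q) (sym (+-cancelʳ-≡ 1 _ _ p)) small))
    ... | true  | _     | p rewrite Xx = contradiction (cuts X FX) (<⇒≱ (subst (_< q) (sym (+-cancelʳ-≡ 0 _ _ p)) small))

  -- If `Y ∩ Z` is odd, so is `Y ∪ Z`, and submodularity applies. Otherwise `Y ∖ Z` and `Y ∪ ∁ Z`
  -- are odd, and submodularity is applied to `Y` and `∁ Z`. There it is strict, because `e₁` runs
  -- from outside `Y ∪ Z` into `Y ∩ Z`, so this case contradicts `cuts`.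
  uncross : ∀ Y Z → Tight Y → Tight Z → Tight (Y ∩ Z)
  uncross Y Z (FY , Y≤q , Yx , Yu) (FZ , Z≤q , Zx , Zu) with ap F (Y ∩ Z) in F∩
  ... | true = refl , +-cancelʳ-≤ q _ _ (≤-trans (+-monoʳ-≤ (ρ t h ⊤ₛ (Y ∩ Z)) (cuts (Y ∪ Z) F∪))
                        (≤-trans (ρ-submodular t h ⊤ₛ Y Z) (+-mono-≤ Y≤q Z≤q)))
             , cong₂ _∧_ Yx Zx , cong (_∧ Z u) Yu
    where
    F∪ : ap F (Y ∪ Z) ≡ true
    F∪ = trans (ap-∪ F Y Z) (cong₂ _xor_ FY (cong₂ _xor_ FZ F∩))
  ... | false = contradiction (≤-trans (+-mono-≤ (cuts (Y ∖ Z) F∖) (cuts (Y ∪ ∁ Z) F∖′))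
                                       (≤-refl {ρ t h ⊤ₛ (Y ∖ Z) + ρ t h ⊤ₛ (Y ∪ ∁ Z)}))
                              (<⇒≱ (<-≤-trans strict (+-mono-≤ Y≤q (subst (_≤ q) (sym (balanced-∁ t h bal Z)) Z≤q))))
    where
    F∖ : ap F (Y ∖ Z) ≡ true
    F∖ = trans (ap-∖ F Y Z) (cong₂ _xor_ FY F∩)
    F∖′ : ap F (Y ∪ ∁ Z) ≡ true
    F∖′ = trans (ap-∪ F Y (∁ Z)) (cong₂ _xor_ FY (cong₂ _xor_ (trans (ap-∁ F F⊤ Z) FZ) F∖))
    strict : ρ t h ⊤ₛ (Y ∖ Z) + ρ t h ⊤ₛ (Y ∪ ∁ Z) < ρ t h ⊤ₛ Y + ρ t h ⊤ₛ (∁ Z)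
    strict = sum-+-< {m} (λ e → ≤ᵇ⇒≤ _ _ (truth-table 4
        (λ a b c d → b2n (not (a ∧ not c) ∧ (b ∧ not d)) + b2n (not (a ∨ not c) ∧ (b ∨ not d)) ≤ᵇ
                     b2n (not a ∧ b) + b2n (not (not c) ∧ not d)) _ (Y (t e)) (Y (h e)) (Z (t e)) (Z (h e))))
      e₁ at-e₁
      where
      at-e₁ : b2n (not (Y u ∧ not (Z u)) ∧ (Y (h e₁) ∧ not (Z (h e₁)))) + b2n (not (Y u ∨ not (Z u)) ∧ (Y (h e₁) ∨ not (Z (h e₁)))) <
              b2n (not (Y u) ∧ Y (h e₁)) + b2n (not (not (Z u)) ∧ not (Z (h e₁)))
      at-e₁ rewrite h₁ | Yx | Zx | Yu | Zu = ≤-refl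

  leaving : ∃ Leaves
  leaving = proj₁ out , does-true (_ ≟ x) (trans (sym (not-involutive _)) (∧-trueˡ (proj₂ out))) ,
            λ he → false≢true (not-true (∧-trueʳ {not (not (⁅ x ⁆ (t (proj₁ out))))} (proj₂ out)))
                              (trans (cong ⁅ x ⁆ he) (does-refl x))
    where
    enters : 0 < ρ t h ⊤ₛ ⁅ x ⁆
    enters = <-≤-trans at-e₁ (term≤sum (λ e → b2n (not (⁅ x ⁆ (t e)) ∧ ⁅ x ⁆ (h e))) e₁)
      where
      at-e₁ : 0 < b2n (not (⁅ x ⁆ u) ∧ ⁅ x ⁆ (h e₁))
      at-e₁ rewrite h₁ | does-refl x | dec-false (u ≟ x) t₁ = ≤-refl
    out = sum-positive (λ e → not (not (⁅ x ⁆ (t e))) ∧ not (⁅ x ⁆ (h e)))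
                       (subst (0 <_) (sym (balanced-∁ t h bal ⁅ x ⁆)) enters)

  -- By minimality no arc leaving x has its head in `Y`: intersecting with a tight set that avoids
  -- the head would give a smaller one. Removing the even vertex x from `Y` hence creates no
  -- entering arc and loses `e₁`, so an odd set would have indegree below `q`.
  minimal-tight : (∀ e → Leaves e → Bad e) → ∀ Y → Tight Y → (∀ Z → Tight Z → card Y ≤ card Z) → ⊥
  minimal-tight all-bad Y tight@(FY , Y≤q , Yx , Yu) least = <⇒≱ (<-≤-trans smaller Y≤q) (cuts (Y ∖ ⁅ x ⁆) F-smaller)
    where
    avoids : ∀ e → Leaves e → Y (h e) ≡ false
    avoids e l with Y (h e) in Ye | bad⇒tight l (all-bad e l)
    ... | false | _ = refl
    ... | true  | Z , Z-tight , Ze = contradiction (least (Y ∩ Z) (uncross Y Z tight Z-tight))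
          (<⇒≱ (card-< (λ v → ∧-trueˡ) (h e , cong₂ (λ a b → a ∧ not (a ∧ b)) Ye Ze)))
    F-smaller : ap F (Y ∖ ⁅ x ⁆) ≡ true
    F-smaller = trans (ap-∖ F Y ⁅ x ⁆) (cong₂ _xor_ FY (trans (ext F Y∩x) Fx))
      where
      Y∩x : Y ∩ ⁅ x ⁆ ≗ ⁅ x ⁆
      Y∩x v with v ≟ x
      ... | yes refl = trans (∧-identityʳ _) Yx
      ... | no _     = ∧-zeroʳ _
    smaller : ρ t h ⊤ₛ (Y ∖ ⁅ x ⁆) < ρ t h ⊤ₛ Y
    smaller = sum-mono-< {m} (λ e → b2n-mono (pointwise e)) e₁ at-e₁
      where
      pointwise : ∀ e → not ((Y ∖ ⁅ x ⁆) (t e)) ∧ (Y ∖ ⁅ x ⁆) (h e) ≡ true → not (Y (t e)) ∧ Y (h e) ≡ true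
      pointwise e p with t e ≟ x | h e ≟ x | Y (t e) | Y (h e) in Ye
      ... | yes te | no he | _ | true = false≢true (avoids e (te , he)) Ye
      ... | yes te | no he | true | false = p
      ... | yes te | no he | false | false = p
      ... | no _ | no _ | false | true = refl
      ... | no _ | no _ | true  | true = p
      ... | no _ | no _ | false | false = p
      ... | no _ | yes _ | false | true = refl
      ... | yes _ | yes _ | false | true = refl
      ... | yes _ | yes _ | true | true = p
      ... | yes _ | yes _ | true | false = p
      ... | yes _ | yes _ | false | false = p
      at-e₁ : b2n (not ((Y ∖ ⁅ x ⁆) u) ∧ (Y ∖ ⁅ x ⁆) (h e₁)) < b2n (not (Y u) ∧ Y (h e₁))
      at-e₁ rewrite h₁ | does-refl x | Yx | Yu = ≤-refl

  not-all-bad : ¬ (∀ e → Leaves e → Bad e)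
  not-all-bad all-bad = case leaving of λ { (e , l) → case bad⇒tight l (all-bad e l) of λ { (Y , tight , _) →
    case argmin tight-resp tight? (Y , tight) of λ { (Z , Z-tight , least) → minimal-tight all-bad Z Z-tight least } } }

  splittable : ∃ λ e₂ → Leaves e₂ × LargeCuts t (swap h e₁ e₂) q F
  splittable with any? (λ e → ((t e ≟ x) ×-dec ¬? (h e ≟ x)) ×-dec ¬? (bad? e))
  ... | yes (e , l , ¬bad) = e , l , λ X FX → ≮⇒≥ λ small → ¬bad (X , FX , small)
  ... | no ¬p = contradiction (λ e l → case bad? e of λ { (yes b) → b ; (no ¬b) → contradiction (e , l , ¬b) ¬p }) not-all-bad

parity-⊕ : ∀ {m n} (t h : Fin m → Fin n) J K X → parity t h (J ⊕ K) X ≡ parity t h J X xor parity t h K X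
parity-⊕ t h J K X = trans
  (xsum-cong λ e → ==⇒≡ (truth-table 3 (λ a b c → ((a xor b) ∧ c) == ((a ∧ c) xor (b ∧ c))) _ (J e) (K e) (X (t e) xor X (h e))))
  (xsum-xor (λ e → J e ∧ (X (t e) xor X (h e))) _)

-- The split arc is replaced by the path of `e₁` and `e₂`: both inherit its membership through `σ`,
-- while the loop that stood at `e₂` crosses no set.
lift-packing : ∀ {m n q} (t h : Fin m → Fin n) (F : Lin n) {e₁ e₂} → h e₁ ≡ t e₂ → e₁ ≢ e₂ →
               Packing t (swap h e₁ e₂) q F → Packing t h q F
lift-packing {m} {n} {q} t h F {e₁} {e₂} meet e₁≢e₂ (J , disjoint , J-parity) =
  (λ i → J i ∘ σ) , (λ i j e → disjoint i j (σ e)) , λ i X → trans (same i X) (J-parity i X)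
  where
  h′ = swap h e₁ e₂
  σ : Fin m → Fin m
  σ f = if does (f ≟ e₂) then e₁ else f
  σ-other : ∀ {f} → f ≢ e₂ → σ f ≡ f
  σ-other {f} p rewrite dec-false (f ≟ e₂) p = refl
  σ-e₂ : σ e₂ ≡ e₁
  σ-e₂ rewrite does-refl e₂ = refl
  same : ∀ i X → parity t h (J i ∘ σ) X ≡ parity t h′ (J i) X
  same i X = xsum-exchange₂ _ _ e₁≢e₂
    (λ f p q → cong₂ (λ g w → J i g ∧ (X (t f) xor X w)) (σ-other q) (sym (swap-other h f p q)))
    at-ends
    where
    at-ends : (J i (σ e₁) ∧ (X (t e₁) xor X (h e₁))) xor (J i (σ e₂) ∧ (X (t e₂) xor X (h e₂))) ≡
              (J i e₁ ∧ (X (t e₁) xor X (h′ e₁))) xor (J i e₂ ∧ (X (t e₂) xor X (h′ e₂)))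
    at-ends rewrite σ-other e₁≢e₂ | σ-e₂ | swap-i h {e₁} {e₂} | swap-j h {e₁} {e₂} e₁≢e₂ | meet =
      ==⇒≡ (truth-table 5 (λ j k a b c → ((j ∧ (a xor b)) xor (j ∧ (b xor c))) == ((j ∧ (a xor c)) xor (k ∧ (b xor b)))) _
                          (J i e₁) (J i e₂) (X (t e₁)) (X (t e₂)) (X (h e₂)))

-- `isolated` says that only loops remain at `x`. `closed` says that a set crossed by no arc stays
-- so; it keeps the vertices already removed in the induction separate from the rest.
record SplitOff {m n} (q : ℕ) (t h : Fin m → Fin n) (F : Lin n) (x : Fin n) : Set where
  field
    h′       : Fin m → Fin n
    balanced : Balanced t h′
    cuts     : LargeCuts t h′ q F
    isolated : ∀ e → ⁅ x ⁆ (t e) ≡ ⁅ x ⁆ (h′ e)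
    closed   : ∀ (W : VS n) → W ∘ t ≗ W ∘ h → W ∘ t ≗ W ∘ h′
    lift     : Packing t h′ q F → Packing t h q F

-- Every splitting lowers the indegree of `x` by one, and `fuel` bounds this indegree. When it is
-- zero, balance shows that no arc leaves `x` either.
split-off : ∀ {m n q} fuel (t h : Fin m → Fin n) (F : Lin n) → Balanced t h → LargeCuts t h q F →
            ap F ⊤ₛ ≡ false → ∀ x → ap F ⁅ x ⁆ ≡ false → ρ t h ⊤ₛ ⁅ x ⁆ ≤ fuel → SplitOff q t h F x
split-off fuel t h F bal cuts F⊤ x Fx bound with ρ t h ⊤ₛ ⁅ x ⁆ in deg
... | zero = record
  { h′ = h ; balanced = bal ; cuts = cuts ; closed = λ _ p → p ; lift = λ p → p
  ; isolated = λ e → no-crossing (⁅ x ⁆ (t e)) (⁅ x ⁆ (h e)) (sum-zero⁻ _ deg e)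
                       (sum-zero⁻ _ (trans (balanced-∁ t h bal ⁅ x ⁆) deg) e) }
  where
  no-crossing : ∀ a b → not a ∧ b ≡ false → not (not a) ∧ not b ≡ false → a ≡ b
  no-crossing true  true  _ _ = refl
  no-crossing false false _ _ = refl
split-off zero t h F bal cuts F⊤ x Fx () | suc d
split-off {q = q} (suc fuel) t h F bal cuts F⊤ x Fx bound | suc d = step (sum-positive _ (subst (0 <_) (sym deg) z<s))
  where
  step : (∃ λ e₁ → not (⁅ x ⁆ (t e₁)) ∧ ⁅ x ⁆ (h e₁) ≡ true) → SplitOff q t h F x
  step (e₁ , enters) = continue splittable
    where
    h₁ : h e₁ ≡ x
    h₁ = does-true (h e₁ ≟ x) (∧-trueʳ {not (⁅ x ⁆ (t e₁))} enters)
    t₁ : t e₁ ≢ x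
    t₁ p = false≢true (not-true (∧-trueˡ enters)) (trans (cong ⁅ x ⁆ p) (does-refl x))
    open SplitArc t h F bal cuts F⊤ Fx h₁ t₁
    continue : (∃ λ e₂ → Leaves e₂ × LargeCuts t (swap h e₁ e₂) q F) → SplitOff q t h F x
    continue (e₂ , l , cuts′) = record
      { h′ = R.h′ ; balanced = R.balanced ; cuts = R.cuts ; isolated = R.isolated
      ; closed = λ W p → R.closed W (swap-closed W p)
      ; lift   = λ p → lift-packing t h F (trans h₁ (sym (proj₁ l))) (leaves⇒≢ l) (R.lift p) }
      where
      swap-closed : ∀ W → W ∘ t ≗ W ∘ h → W ∘ t ≗ W ∘ swap h e₁ e₂
      swap-closed W p f = case f ≟ e₁ of λ
        { (yes refl) → trans (trans (p e₁) (cong W (trans h₁ (sym (proj₁ l))))) (trans (p e₂) (cong W (sym (swap-i h {e₁} {e₂}))))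
        ; (no f≢e₁)  → case f ≟ e₂ of λ
          { (yes refl) → cong W (trans (proj₁ l) (trans (sym h₁) (sym (swap-j h {e₁} {e₂} (leaves⇒≢ l)))))
          ; (no f≢e₂)  → trans (p f) (cong W (sym (swap-other h f f≢e₁ f≢e₂))) } }
      fewer : ρ t (swap h e₁ e₂) ⊤ₛ ⁅ x ⁆ + 1 ≡ suc d
      fewer = trans (sym change) (trans (+-identityʳ _) deg)
        where
        change : ρ t h ⊤ₛ ⁅ x ⁆ + 0 ≡ ρ t (swap h e₁ e₂) ⊤ₛ ⁅ x ⁆ + 1
        change = subst₂ (λ a b → ρ t h ⊤ₛ ⁅ x ⁆ + a ≡ ρ t (swap h e₁ e₂) ⊤ₛ ⁅ x ⁆ + b) after before (swap-ρ l ⁅ x ⁆)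
          where
          after : b2n (not (⁅ x ⁆ u) ∧ ⁅ x ⁆ (h e₂)) + b2n (not (⁅ x ⁆ x) ∧ ⁅ x ⁆ x) ≡ 0
          after rewrite does-refl x | dec-false (u ≟ x) t₁ | dec-false (h e₂ ≟ x) (proj₂ l) = refl
          before : b2n (not (⁅ x ⁆ u) ∧ ⁅ x ⁆ x) + b2n (not (⁅ x ⁆ x) ∧ ⁅ x ⁆ (h e₂)) ≡ 1
          before rewrite does-refl x | dec-false (u ≟ x) t₁ = refl
      module R = SplitOff (split-off fuel t (swap h e₁ e₂) F (swap-balanced l) cuts′ F⊤ x Fx
                   (≤-pred (≤-trans (≤-reflexive (trans (+-comm 1 _) fewer)) bound)))

restrict : ∀ {n} → VS n → Lin n → Lin n
restrict A F = record
  { ap  = λ X → ap F (X ∩ A)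
  ; ext = λ eq → ext F λ v → cong (_∧ A v) (eq v)
  ; add = λ X Y → trans (ext F λ v → ==⇒≡ (truth-table 3 (λ a b c → ((a xor b) ∧ c) == ((a ∧ c) xor (b ∧ c))) _ (X v) (Y v) (A v)))
                        (add F (X ∩ A) (Y ∩ A)) }

infixr 6 _⊞_
_⊞_ : ∀ {n} → Lin n → Lin n → Lin n
F ⊞ G = record
  { ap  = λ X → ap F X xor ap G X
  ; ext = λ eq → cong₂ _xor_ (ext F eq) (ext G eq)
  ; add = λ X Y → trans (cong₂ _xor_ (add F X Y) (add G X Y)) (xor-interchange (ap F X) _ _ _) }

-- The heads of the arcs of E are listed as r, padded with a.
heads : ∀ {m n} q (E : VS m) (h : Fin m → Fin n) (A : VS n) {a} → A a ≡ true →
        (∀ e → E e ≡ true → A (h e) ≡ true) → card E ≤ q →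
        ∃ λ (r : Fin q → Fin n) → (∀ j → A (r j) ≡ true) ×
          (∀ B → sumFin m (λ e → b2n (E e ∧ B (h e))) ≤ hits r B)
heads {zero} q E h A {a} Aa inA b = (λ _ → a) , (λ _ → Aa) , λ _ → z≤n
heads {suc m} q E h A Aa inA b with E zero in E₀
... | false = heads q (E ∘ suc) (h ∘ suc) A Aa (inA ∘ suc) b
heads {suc m} (suc q) E h A Aa inA (s≤s b) | true with heads q (E ∘ suc) (h ∘ suc) A Aa (inA ∘ suc) b
... | r , r∈A , bound = (λ { zero → h zero ; (suc j) → r j }) , (λ { zero → inA zero E₀ ; (suc j) → r∈A j }) ,
                        λ B → +-monoʳ-≤ (b2n (B (h zero))) (bound B)

-- One step of the induction: a minimal set A of small indegree is contracted to a, and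
-- a packing of the contracted graph is extended into A.
module Contract {m n q} (t h : Fin m → Fin n) (F : Lin n) (bal : Balanced t h) (cuts : LargeCuts t h q F)
                (F⊤ : ap F ⊤ₛ ≡ false) (A : VS n) {a} (Aa : A a ≡ true) (small : ρ t h ⊤ₛ A < q)
                (large : ∀ B → B ⊆ A → Nonempty B → Nonempty (A ∖ B) → q ≤ ρ t h ⊤ₛ B) where

  F-A : ap F A ≡ false
  F-A with ap F A in eq
  ... | false = refl
  ... | true  = contradiction (cuts A eq) (<⇒≱ small)

  -- Contraction without renaming: the vertex set stays `Fin n`, and the vertices of `A` other than
  -- `a` merely lose all their arcs.
  π : Fin n → Fin n
  π v = if A v then a else v

  π-in : ∀ {v} → A v ≡ true → π v ≡ a
  π-in {v} Av rewrite Av = refl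

  t₁ h₁ : Fin m → Fin n
  t₁ = π ∘ t
  h₁ = π ∘ h

  F₁ : Lin n
  F₁ = pull π F

  a∘π : ⁅ a ⁆ ∘ π ≗ A
  a∘π v with A v in Av
  ... | true  = does-refl a
  ... | false = dec-false (v ≟ a) λ { refl → false≢true Av Aa }

  F₁-a : ap F₁ ⁅ a ⁆ ≡ false
  F₁-a = trans (ext F a∘π) F-A

  balanced₁ : Balanced t₁ h₁
  balanced₁ φ = bal (φ ∘ π)

  cuts₁ : LargeCuts t₁ h₁ q F₁
  cuts₁ X = cuts (X ∘ π)

  inner : VS m
  inner e = A (t e) ∧ A (h e)

  -- Arcs not inside `A` are taken from the packing of the contracted graph. The parities that they
  -- leave open at the vertices of `A` are supplied by disjoint sets of inner arcs from `edmonds`.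
  extend : Packing t₁ h₁ q F₁ → Packing t h q F
  extend (J , disjoint , J-parity) = combine (edmonds A q r inner r∈A (λ e p → ∧-trueˡ p , ∧-trueʳ {A (t e)} p) enough P P-supp P-A)
    where
    open Branchings t h

    entering : VS m
    entering e = not (A (t e)) ∧ A (h e)

    roots = heads q entering h A Aa (λ e → ∧-trueʳ {not (A (t e))}) (<⇒≤ small)
    r = proj₁ roots
    r∈A = proj₁ (proj₂ roots)

    -- `A` itself contains all `q` roots. A proper nonempty subset has indegree at least `q` by the
    -- choice of `A`, and each arc entering it either is inner or enters `A`, in which case its head
    -- is among the roots.
    enough : ∀ B → B ⊆ A → Nonempty B → q ≤ ρ t h inner B + hits r B
    enough B B⊆A B≠∅ with ⊆-∨-∖ A B
    ... | inj₁ A⊆B = ≤-trans (≤-reflexive (sym all-hit)) (m≤n+m _ _)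
      where
      all-hit : hits r B ≡ q
      all-hit = trans (sum-cong {q} λ j → cong b2n (A⊆B (r j) (r∈A j))) (sum-one q)
    ... | inj₂ rest = ≤-trans (large B B⊆A B≠∅ rest)
      (≤-trans (≤-trans (sum-mono {m} pointwise) (≤-reflexive (sum-+ {m} _ _))) (+-monoʳ-≤ (ρ t h inner B) (proj₂ (proj₂ roots) B)))
      where
      pointwise : ∀ e → b2n (not (B (t e)) ∧ B (h e)) ≤
                        b2n (inner e ∧ (not (B (t e)) ∧ B (h e))) + b2n (entering e ∧ B (h e))
      pointwise e with B (h e) in Bh
      ... | false rewrite ∧-zeroʳ (not (B (t e))) = z≤n
      ... | true rewrite B⊆A (h e) Bh with A (t e) | B (t e)
      ...   | true  | true  = ≤-refl
      ...   | true  | false = ≤-refl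
      ...   | false | true  = z≤n
      ...   | false | false = ≤-refl

    outer : Fin q → VS m
    outer i = J i ∖ inner

    -- `Y` is a preimage under `π`, hence contains all of `A` or nothing of it. The discarded inner
    -- arcs are loops at `a` after contraction and do not affect its parity.
    outer-parity : ∀ i X Y → (∀ v → X (π v) ≡ Y v) → parity t h (outer i) Y ≡ ap F Y
    outer-parity i X Y eq = trans (xsum-cong pointwise) (trans (J-parity i X) (ext F eq))
      where
      pointwise : ∀ e → outer i e ∧ (Y (t e) xor Y (h e)) ≡ J i e ∧ (X (t₁ e) xor X (h₁ e))
      pointwise e = trans (cong (outer i e ∧_) (cong₂ _xor_ (sym (eq (t e))) (sym (eq (h e)))))
        (drop (J i e) (A (t e)) (A (h e)) _ _ λ At Ah → cong X (trans (π-in At) (sym (π-in Ah))))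
        where
        drop : ∀ j p q x y → (p ≡ true → q ≡ true → x ≡ y) → (j ∧ not (p ∧ q)) ∧ (x xor y) ≡ j ∧ (x xor y)
        drop j true true x y eq rewrite eq refl refl | xor-same y = trans (∧-zeroʳ _) (sym (∧-zeroʳ j))
        drop j true false x y eq = cong (_∧ _) (∧-identityʳ j)
        drop j false q    x y eq = cong (_∧ _) (∧-identityʳ j)

    -- The demand remaining in `A` once the outer arcs are counted; over two elements, adding their
    -- parity is subtracting it.
    P : Fin q → Lin n
    P i = restrict A (F ⊞ parityLin t h (outer i))

    P-supp : ∀ i → Supported (P i) A
    P-supp i X p = ap-∅ (F ⊞ parityLin t h (outer i)) λ v → X∩A v (A v) refl
      where
      X∩A : ∀ v b → A v ≡ b → X v ∧ A v ≡ false
      X∩A v true  Av = cong (_∧ A v) (p v Av)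
      X∩A v false Av = trans (cong (X v ∧_) Av) (∧-zeroʳ (X v))

    P-A : ∀ i → ap (P i) A ≡ false
    P-A i = trans (ext (F ⊞ parityLin t h (outer i)) λ v → ∧-idem (A v))
                  (trans (cong (ap F A xor_) (outer-parity i ⁅ a ⁆ A a∘π)) (xor-same (ap F A)))

    combine : (∃ λ (K : Fin q → VS m) → (∀ i → K i ⊆ inner) ×
                (∀ i j e → K i e ≡ true → K j e ≡ true → i ≡ j) ×
                (∀ i X → parity t h (K i) X ≡ ap (P i) X)) → Packing t h q F
    combine (K , K⊆ , K-disjoint , K-parity) = L , L-disjoint , L-parity
      where
      L : Fin q → VS m
      L i = K i ⊕ outer i
      L-split : ∀ i e → L i e ≡ true → (inner e ≡ true × K i e ≡ true) ⊎ (inner e ≡ false × J i e ≡ true)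
      L-split i e p with K i e in Ke | J i e | inner e in Ie
      ... | true  | _     | true  = inj₁ (refl , refl)
      ... | true  | _     | false = false≢true Ie (K⊆ i e Ke)
      ... | false | true  | false = inj₂ (refl , refl)
      ... | false | true  | true  = contradiction p λ ()
      ... | false | false | _     = contradiction p λ ()
      L-disjoint : ∀ i j e → L i e ≡ true → L j e ≡ true → i ≡ j
      L-disjoint i j e p q with L-split i e p | L-split j e q
      ... | inj₁ (_ , x) | inj₁ (_ , y) = K-disjoint i j e x y
      ... | inj₂ (_ , x) | inj₂ (_ , y) = disjoint i j e x y
      ... | inj₁ (x , _) | inj₂ (y , _) = false≢true y x
      ... | inj₂ (x , _) | inj₁ (y , _) = false≢true x y
      L-parity : ∀ i X → parity t h (L i) X ≡ ap F X
      L-parity i X = begin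
        parity t h (L i) X                                   ≡⟨ parity-⊕ t h (K i) (outer i) X ⟩
        parity t h (K i) X xor ap O X                        ≡⟨ cong (_xor ap O X) (K-parity i X) ⟩
        (ap F (X ∩ A) xor ap O (X ∩ A)) xor ap O X           ≡⟨ regroup (ap F (X ∩ A)) (ap O (X ∩ A)) (ap O X) ⟩
        ap F (X ∩ A) xor (ap O X xor ap O (X ∩ A))           ≡⟨ cong (ap F (X ∩ A) xor_) (sym (ap-∖ O X A)) ⟩
        -- `X ∖ A` is disjoint from `A` and so a preimage under `π`: there the outer arcs alone
        -- already have the right parity.
        ap F (X ∩ A) xor ap O (X ∖ A)                        ≡⟨ cong (ap F (X ∩ A) xor_) (outer-parity i (X ∖ A) (X ∖ A) saturated) ⟩
        ap F (X ∩ A) xor ap F (X ∖ A)                        ≡⟨ cong (ap F (X ∩ A) xor_) (ap-∖ F X A) ⟩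
        ap F (X ∩ A) xor (ap F X xor ap F (X ∩ A))           ≡⟨ cancel (ap F (X ∩ A)) (ap F X) ⟩
        ap F X                                               ∎
        where
        open ≡-Reasoning
        O = parityLin t h (outer i)
        regroup : ∀ a b c → (a xor b) xor c ≡ a xor (c xor b)
        regroup a b c = ==⇒≡ (truth-table 3 (λ a b c → ((a xor b) xor c) == (a xor (c xor b))) _ a b c)
        cancel : ∀ a b → a xor (b xor a) ≡ b
        cancel a b = ==⇒≡ (truth-table 2 (λ a b → (a xor (b xor a)) == b) _ a b)
        saturated : ∀ v → (X ∖ A) (π v) ≡ (X ∖ A) v
        saturated v with A v in Av
        ... | true  rewrite Aa = trans (∧-zeroʳ (X a)) (sym (∧-zeroʳ (X v)))
        ... | false rewrite Av = refl

-- Induction on the size of `U`, a set that supports `F` and is crossed by no arc. While `U` is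
-- nonempty it has indegree zero itself, so a minimal nonempty subset `A` of indegree below `q`
-- exists. Contracting `A` and splitting off `a` allows `U ∖ A` to take the place of `U`.
pack : ∀ {m n q} fuel (U : VS n) (t h : Fin m → Fin n) (F : Lin n) → card U ≤ fuel → 0 < q →
       Balanced t h → LargeCuts t h q F → ap F ⊤ₛ ≡ false → Supported F U → U ∘ t ≗ U ∘ h → Packing t h q F
pack {m} {n} {q} fuel U t h F bound 0<q bal cuts F⊤ supp closed with nonempty? U
... | no U=∅ = (λ _ → ∅ₛ) , (λ _ _ _ ()) , λ i X → trans (xsum-false {m} λ _ → refl)
                 (sym (supp X λ v Uv → contradiction (v , Uv) U=∅))
... | yes U≠∅ = go fuel bound (argmin low-resp low? (U , (λ _ p → p) , U≠∅ , U-low))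
  where
  Low : VS n → Set
  Low A = A ⊆ U × Nonempty A × ρ t h ⊤ₛ A < q
  low? : ∀ A → Dec (Low A)
  low? A = (A ⊆? U) ×-dec (nonempty? A ×-dec (ρ t h ⊤ₛ A <? q))
  low-resp : Respects Low
  low-resp eq (p , (v , w) , l) = (λ v Yv → p v (trans (eq v) Yv)) , (v , trans (sym (eq v)) w) , subst (_< q) (ρ-ext t h ⊤ₛ eq) l
  U-low : ρ t h ⊤ₛ U < q
  U-low = subst (_< q) (sym (sum-zero {m} λ e → cong b2n (trans (cong (λ b → not b ∧ U (h e)) (closed e)) (¬b∧b (U (h e)))))) 0<q
    where
    ¬b∧b : ∀ b → not b ∧ b ≡ false
    ¬b∧b true  = refl
    ¬b∧b false = refl
  go : ∀ fuel → card U ≤ fuel → (∃ λ A → Low A × (∀ Z → Low Z → card A ≤ card Z)) → Packing t h q F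
  go fuel bound (A , (A⊆U , (a , Aa) , small) , least) = finish fuel bound
    where
    open Contract t h F bal cuts F⊤ A Aa small
      (λ B B⊆A B≠∅ rest → ≮⇒≥ λ B-small → <⇒≱ (card-< B⊆A rest) (least B ((λ v p → A⊆U v (B⊆A v p)) , B≠∅ , B-small)))
    open SplitOff (split-off (ρ t₁ h₁ ⊤ₛ ⁅ a ⁆) t₁ h₁ F₁ balanced₁ cuts₁ F⊤ a F₁-a ≤-refl)
      renaming (balanced to balanced₂; cuts to cuts₂; closed to closed₂)
    fewer : card (U ∖ A) < card U
    fewer = card-< (λ v → ∧-trueˡ) (a , cong₂ (λ x y → x ∧ not (x ∧ not y)) (A⊆U a Aa) Aa)
    U∘π : ∀ v → U (π v) ≡ U v
    U∘π v with A v in Av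
    ... | true  = trans (A⊆U a Aa) (sym (A⊆U v Av))
    ... | false = refl
    off-a : ∀ v → (A ∖ ⁅ a ⁆) (π v) ≡ false
    off-a v with A v in Av
    ... | true  = trans (cong (λ b → A a ∧ not b) (does-refl a)) (∧-zeroʳ (A a))
    ... | false = cong (_∧ not (⁅ a ⁆ v)) Av
    split-A : ∀ v → (U ∖ A) v ≡ U v ∧ not (⁅ a ⁆ v ∨ (A ∖ ⁅ a ⁆) v)
    split-A v with v ≟ a
    ... | yes refl = cong (λ b → U v ∧ not b) Aa
    ... | no _     = cong (λ b → U v ∧ not b) (sym (∧-identityʳ (A v)))
    -- By `split-A` the set is `U` without `a` and without the rest of `A`. No arc crosses any of
    -- these three: `a` is isolated by the splitting, and the other two sets remain uncrossed by
    -- `closed₂`.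
    closed′ : (U ∖ A) ∘ t₁ ≗ (U ∖ A) ∘ h′
    closed′ e = trans (split-A (t₁ e)) (trans
      (cong₂ _∧_ (closed₂ U (λ f → trans (U∘π (t f)) (trans (closed f) (sym (U∘π (h f))))) e)
                 (cong₂ (λ x y → not (x ∨ y)) (isolated e)
                        (closed₂ (A ∖ ⁅ a ⁆) (λ f → trans (off-a (t f)) (sym (off-a (h f)))) e)))
      (sym (split-A (h′ e))))
    -- Depending on whether `X` contains `a`, the preimage of `X` meets `U` in exactly `A`, where
    -- `F` is even, or not at all.
    supp₁ : Supported F₁ (U ∖ A)
    supp₁ X p with X a in Xa
    ... | false = supp (X ∘ π) X∘π
      where
      X∘π : ∀ v → U v ≡ true → X (π v) ≡ false
      X∘π v Uv with A v in Av
      ... | true  = Xa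
      ... | false = p v (cong₂ (λ x y → x ∧ not y) Uv Av)
    ... | true = trans (ap-agree F supp X∘π) F-A
      where
      X∘π : ∀ v → U v ≡ true → X (π v) ≡ A v
      X∘π v Uv with A v in Av
      ... | true  = Xa
      ... | false = p v (cong₂ (λ x y → x ∧ not y) Uv Av)
    finish : ∀ fuel → card U ≤ fuel → Packing t h q F
    finish zero    bound = contradiction (<-≤-trans fewer bound) λ ()
    finish (suc k) bound = extend (lift (pack k (U ∖ A) t₁ h′ F₁ (≤-pred (<-≤-trans fewer bound)) 0<q balanced₂ cuts₂ F⊤ supp₁ closed′))

-- Degrees and the halving of an even edge set

sum-single : ∀ {m} i (g : Fin m → ℕ) → sumFin m (λ j → b2n (does (j ≟ i)) * g j) ≡ g i
sum-single {m} i g = begin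
  sumFin m g′                      ≡⟨ sym (+-identityʳ _) ⟩
  sumFin m g′ + 0                  ≡⟨ sum-exchange g′ (λ _ → 0) i (λ j q → cong (λ b → b2n b * g j) (dec-false (j ≟ i) q)) ⟩
  sumFin m (λ _ → 0) + g′ i        ≡⟨ cong (_+ g′ i) (sum-zero {m} λ _ → refl) ⟩
  b2n (does (i ≟ i)) * g i         ≡⟨ cong (λ b → b2n b * g i) (does-refl i) ⟩
  g i + 0                          ≡⟨ +-identityʳ (g i) ⟩
  g i                              ∎
  where
  open ≡-Reasoning
  g′ : Fin m → ℕ
  g′ j = b2n (does (j ≟ i)) * g j

xsum-++ : ∀ m {n} (g : Fin (m + n) → Bool) →
          xsum (m + n) g ≡ xsum m (λ i → g (i ↑ˡ n)) xor xsum n (λ j → g (m ↑ʳ j))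
xsum-++ zero    g = refl
xsum-++ (suc m) g = trans (cong (g zero xor_) (xsum-++ m (g ∘ suc))) (sym (xor-assoc (g zero) _ _))

double-injective : ∀ {x y} → x + x ≡ y + y → x ≡ y
double-injective {x} {y} p = trans (n≡⌊n+n/2⌋ x) (trans (cong ⌊_/2⌋ p) (sym (n≡⌊n+n/2⌋ y)))

vanishing : ∀ {n} (F : Lin n) → (∀ v → ap F ⁅ v ⁆ ≡ false) → ∀ X → ap F X ≡ false
vanishing F p X = trans (ap-expand F X) (xsum-false λ v → trans (cong (X v ∧_) (p v)) (∧-zeroʳ (X v)))

module Degrees (G : Graph) where

  end : Edge G → Bool → Vertex G
  end e false = proj₁ (ends G e)
  end e true  = proj₂ (ends G e)

  -- The outdegree in `S` if `r` selects the tail of each edge; `not ∘ r` then gives the indegree.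
  dirdeg : (Edge G → Bool) → EdgeSet G → Vertex G → ℕ
  dirdeg r S v = sumFin (m G) (λ e → b2n (S e) * b2n (⁅ v ⁆ (end e (r e))))

  degIn-dirdeg : ∀ r S v → degIn G S v ≡ dirdeg r S v + dirdeg (not ∘ r) S v
  degIn-dirdeg r S v = trans (sum-cong pointwise) (sum-+ _ (λ e → b2n (S e) * b2n (⁅ v ⁆ (end e (not (r e))))))
    where
    pointwise : ∀ e → b2n (S e) * incid G e v ≡
                      b2n (S e) * b2n (⁅ v ⁆ (end e (r e))) + b2n (S e) * b2n (⁅ v ⁆ (end e (not (r e))))
    pointwise e with r e
    ... | false = *-distribˡ-+ (b2n (S e)) _ _
    ... | true  = trans (*-distribˡ-+ (b2n (S e)) _ _) (+-comm (b2n (S e) * b2n (⁅ v ⁆ (end e false))) _)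

  degIn-cong : ∀ {S T} → S ≗ T → ∀ v → degIn G S v ≡ degIn G T v
  degIn-cong eq v = sum-cong λ e → cong (λ b → b2n b * incid G e v) (eq e)

  degIn-split : ∀ Q R v → R ⊆ Q → degIn G Q v ≡ degIn G R v + degIn G (Q ∖ R) v
  degIn-split Q R v R⊆Q = trans (sum-cong λ e → trans (cong (_* incid G e v) (pointwise (Q e) (R e) (R⊆Q e)))
                                                (*-distribʳ-+ (incid G e v) (b2n (R e)) _))
                                (sum-+ _ (λ e → b2n ((Q ∖ R) e) * incid G e v))
    where
    pointwise : ∀ q r → (r ≡ true → q ≡ true) → b2n q ≡ b2n r + b2n (q ∧ not r)
    pointwise true  true  _ = refl
    pointwise true  false _ = refl
    pointwise false false _ = refl
    pointwise false true  p = case p refl of λ ()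

  parityIn : EdgeSet G → VSet G → Bool
  parityIn = parity (λ e → end e false) (λ e → end e true)

  odd-degIn : ∀ S v → odd (degIn G S v) ≡ parityIn S ⁅ v ⁆
  odd-degIn S v = trans (odd-sum {m G} (λ e → b2n (S e) * incid G e v)) (xsum-cong {m G} λ e →
    trans (odd-b2n* (S e) (incid G e v))
          (cong (S e ∧_) (trans (odd-+ (b2n (⁅ v ⁆ (end e false))) _) (cong₂ _xor_ (odd-b2n (⁅ v ⁆ (end e false))) (odd-b2n (⁅ v ⁆ (end e true)))))))

  even-degIn : ∀ S → (∀ v → odd (degIn G S v) ≡ false) → ∀ X → parityIn S X ≡ false
  even-degIn S even = vanishing (parityLin (λ e → end e false) (λ e → end e true) S)
                                (λ v → trans (sym (odd-degIn S v)) (even v))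

Near : ℕ → ℕ → Set
Near x y = x ≤ y + 2 × y ≤ x + 2

Halving : (G : Graph) → EdgeSet G → EdgeSet G → EdgeSet G → Set
Halving G Q R R′ = R′ ⊆ Q × (∀ v → odd (degIn G R′ v) ≡ odd (degIn G R v) × Near (degIn G R′ v) (degIn G (Q ∖ R′) v))

module Halve (G : Graph) (Q R : EdgeSet G) (R⊆Q : R ⊆ Q) (even : ∀ v → odd (degIn G Q v) ≡ false) where
  open Degrees G

  private
    M = m G
    N = n G

    first = euler _≟_ M end Q (even-degIn Q even)
    s = proj₁ first

  -- An Eulerian orientation of Q, reversed on R: its outdegrees have the parity of half the degree plus d_R.
  r : Edge G → Bool
  r e = s e xor R e

  balanced : ∀ v → dirdeg s Q v ≡ dirdeg (not ∘ s) Q v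
  balanced v = proj₂ first (b2n ∘ ⁅ v ⁆)

  half : Vertex G → ℕ
  half = dirdeg s Q

  degQ : ∀ v → degIn G Q v ≡ half v + half v
  degQ v = trans (degIn-dirdeg s Q v) (cong (half v +_) (sym (balanced v)))

  outOdd : Vertex G → Bool
  outOdd v = odd (dirdeg r Q v)

  odd-dirdeg : ∀ r S v → odd (dirdeg r S v) ≡ xsum M (λ e → S e ∧ ⁅ v ⁆ (end e (r e)))
  odd-dirdeg r S v = trans (odd-sum {M} (λ e → b2n (S e) * b2n (⁅ v ⁆ (end e (r e))))) (xsum-cong {M} λ e → trans (odd-b2n* (S e) _) (cong (S e ∧_) (odd-b2n _)))

  -- Reversing an edge changes the outdegree by one at each of its ends, and not at all for a loop.
  -- Modulo 2 the reversal on `R` thus adds the degree in `R`.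
  outOdd-half : ∀ v → outOdd v ≡ odd (half v) xor odd (degIn G R v)
  outOdd-half v = begin
    odd (dirdeg r Q v)                                       ≡⟨ odd-dirdeg r Q v ⟩
    xsum M (λ e → Q e ∧ ⁅ v ⁆ (end e (s e xor R e)))         ≡⟨ xsum-cong (λ e → reversed e (s e) (Q e) (R e) (R⊆Q e)) ⟩
    xsum M (λ e → (Q e ∧ ⁅ v ⁆ (end e (s e))) xor (R e ∧ (⁅ v ⁆ (end e false) xor ⁅ v ⁆ (end e true)))) ≡⟨ xsum-xor (λ e → Q e ∧ ⁅ v ⁆ (end e (s e))) _ ⟩
    xsum M (λ e → Q e ∧ ⁅ v ⁆ (end e (s e))) xor parityIn R ⁅ v ⁆ ≡⟨ cong₂ _xor_ (sym (odd-dirdeg s Q v)) (sym (odd-degIn R v)) ⟩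
    odd (half v) xor odd (degIn G R v)                       ∎
    where
    open ≡-Reasoning
    reversed : ∀ e b q p → (p ≡ true → q ≡ true) → q ∧ ⁅ v ⁆ (end e (b xor p)) ≡
               (q ∧ ⁅ v ⁆ (end e b)) xor (p ∧ (⁅ v ⁆ (end e false) xor ⁅ v ⁆ (end e true)))
    reversed e b q false p rewrite xor-identityʳ b = sym (xor-identityʳ _)
    reversed e b q true p rewrite p refl = lemma b (⁅ v ⁆ (end e false)) (⁅ v ⁆ (end e true)) refl refl
      where
      lemma : ∀ b x y → x ≡ ⁅ v ⁆ (end e false) → y ≡ ⁅ v ⁆ (end e true) →
              ⁅ v ⁆ (end e (b xor true)) ≡ ⁅ v ⁆ (end e b) xor (x xor y)
      lemma false x y refl refl = ==⇒≡ (truth-table 2 (λ x y → y == (x xor (x xor y))) _ x y)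
      lemma true  x y refl refl = ==⇒≡ (truth-table 2 (λ x y → x == (y xor (x xor y))) _ x y)

  inOdd : ∀ v → odd (dirdeg (not ∘ r) Q v) ≡ outOdd v
  inOdd v = xor-false (trans (sym (odd-+ (dirdeg r Q v) _)) (trans (cong odd (sym (degIn-dirdeg r Q v))) (even v)))
    where
    xor-false : ∀ {x y} → x xor y ≡ false → y ≡ x
    xor-false {true}  {true}  _ = refl
    xor-false {false} {false} _ = refl

  -- The bipartite graph with vertices (v , false), (v , true) and an edge from (t , false)
  -- to (h , true) for each arc th of Q, and one from (v , false) to (v , true) if v has odd outdegree.
  doubled : Fin M ⊎ Fin N → Bool → Vertex G × Bool
  doubled (inj₁ e) false = end e (r e) , false
  doubled (inj₁ e) true  = end e (not (r e)) , true
  doubled (inj₂ v) b     = v , b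

  present : Fin M ⊎ Fin N → Bool
  present (inj₁ e) = Q e
  present (inj₂ v) = outOdd v

  outLin : (Edge G → Bool) → Lin N
  outLin r = record
    { ap  = λ X → xsum M (λ e → Q e ∧ X (end e (r e)))
    ; ext = λ eq → xsum-cong λ e → cong (Q e ∧_) (eq (end e (r e)))
    ; add = λ X Y → trans (xsum-cong λ e → ∧-distribˡ-xor (Q e) _ _) (xsum-xor (λ e → Q e ∧ X (end e (r e))) _) }

  -- The tail and head copies of v have as degrees its outdegree and indegree, which have equal
  -- parity, and the extra edge corrects both. Evenness at single vertices extends to all sets
  -- through `ap-expand`.
  doubled-even : ∀ (X : Vertex G × Bool → Bool) →
    xsum (M + N) (λ i → present (splitAt M i) ∧ (X (doubled (splitAt M i) false) xor X (doubled (splitAt M i) true))) ≡ false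
  doubled-even X = begin
    xsum (M + N) (λ i → g (splitAt M i)) ≡⟨ xsum-++ M (λ i → g (splitAt M i)) ⟩
    xsum M (λ e → g (splitAt M (e ↑ˡ N))) xor xsum N (λ v → g (splitAt M (M ↑ʳ v)))
      ≡⟨ cong₂ _xor_ (xsum-cong λ e → cong g (splitAt-↑ˡ M e N)) (xsum-cong λ v → cong g (splitAt-↑ʳ M N v)) ⟩
    xsum M (g ∘ inj₁) xor xsum N (g ∘ inj₂)
      ≡⟨ cong₂ _xor_ (xsum-cong λ e → ∧-distribˡ-xor (Q e) _ _) (xsum-cong λ v → ∧-distribˡ-xor (outOdd v) _ _) ⟩
    xsum M (λ e → (Q e ∧ X₀ (end e (r e))) xor (Q e ∧ X₁ (end e (not (r e))))) xor
      xsum N (λ v → (outOdd v ∧ X₀ v) xor (outOdd v ∧ X₁ v))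
      ≡⟨ cong₂ _xor_ (xsum-xor (λ e → Q e ∧ X₀ (end e (r e))) _) (xsum-xor (λ v → outOdd v ∧ X₀ v) _) ⟩
    (ap (outLin r) X₀ xor ap (outLin (not ∘ r)) X₁) xor (x₀ xor x₁) ≡⟨ cong (_xor (x₀ xor x₁)) (cong₂ _xor_ (expand r (λ v → refl) X₀) (expand (not ∘ r) inOdd X₁)) ⟩
    (x₀ xor x₁) xor (x₀ xor x₁) ≡⟨ xor-same (x₀ xor x₁) ⟩
    false ∎
    where
    open ≡-Reasoning
    X₀ X₁ : VS N
    X₀ v = X (v , false)
    X₁ v = X (v , true)
    x₀ x₁ : Bool
    x₀ = xsum N (λ v → outOdd v ∧ X₀ v)
    x₁ = xsum N (λ v → outOdd v ∧ X₁ v)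
    g : Fin M ⊎ Fin N → Bool
    g i = present i ∧ (X (doubled i false) xor X (doubled i true))
    expand : ∀ r → (∀ v → odd (dirdeg r Q v) ≡ outOdd v) → ∀ Y → ap (outLin r) Y ≡ xsum N (λ v → outOdd v ∧ Y v)
    expand r eq Y = trans (ap-expand (outLin r) Y) (xsum-cong λ v →
      trans (∧-comm (Y v) _) (cong (_∧ Y v) (trans (sym (odd-dirdeg r Q v)) (eq v))))

  private
    second = euler (≡-dec _≟_ Bool._≟_) (M + N) (doubled ∘ splitAt M) (present ∘ splitAt M) doubled-even

    σ : Fin M ⊎ Fin N → Bool
    σ = proj₁ second ∘ join M N

  -- The edges that start at their tail copy in the Eulerian orientation of the bipartite graph.
  R′ : EdgeSet G
  R′ e = Q e ∧ not (σ (inj₁ e))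

  B′ : EdgeSet G
  B′ = Q ∖ R′

  R′⊆Q : R′ ⊆ Q
  R′⊆Q e = ∧-trueˡ

  private
    weight : (Vertex G × Bool → ℕ) → (Bool → Bool) → Fin M ⊎ Fin N → ℕ
    weight φ d i = b2n (present i) * φ (doubled i (d (σ i)))

    second-balanced : ∀ (φ : Vertex G × Bool → ℕ) →
      sumFin M (weight φ (λ b → b) ∘ inj₁) + sumFin N (weight φ (λ b → b) ∘ inj₂) ≡
      sumFin M (weight φ not ∘ inj₁) + sumFin N (weight φ not ∘ inj₂)
    second-balanced φ = trans (sym (split-sum (λ b → b))) (trans (proj₂ second φ) (split-sum not))
      where
      split-sum : ∀ d → sumFin (M + N) (λ i → b2n (present (splitAt M i)) * φ (doubled (splitAt M i) (d (proj₁ second i)))) ≡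
                        sumFin M (weight φ d ∘ inj₁) + sumFin N (weight φ d ∘ inj₂)
      split-sum d = trans (sum-++ M _) (cong₂ _+_
        (sum-cong λ e → cong (λ i → b2n (present i) * φ (doubled i (d (σ (inj₁ e))))) (splitAt-↑ˡ M e N))
        (sum-cong λ v → cong (λ i → b2n (present i) * φ (doubled i (d (σ (inj₂ v))))) (splitAt-↑ʳ M N v)))

    at : Vertex G → Bool → Vertex G × Bool → ℕ
    at v b (w , c) = b2n (⁅ v ⁆ w ∧ (b == c))

    aux-part : ∀ v b d → sumFin N (weight (at v b) d ∘ inj₂) ≡ b2n (outOdd v) * b2n (b == d (σ (inj₂ v)))
    aux-part v b d = trans (sum-cong λ w → rearrange (outOdd w) (⁅ v ⁆ w) (b == d (σ (inj₂ w)))) (sum-single v _)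
      where
      rearrange : ∀ x y z → b2n x * b2n (y ∧ z) ≡ b2n y * (b2n x * b2n z)
      rearrange x y z = ≡ᵇ⇒≡ _ _ (truth-table 3 (λ x y z → b2n x * b2n (y ∧ z) ≡ᵇ b2n y * (b2n x * b2n z)) _ x y z)

    -- Balance at the tail copy of `v`: arcs starting there come from `R′`, arcs ending there from
    -- `B′`, and the extra edge counts on one of the two sides. `red-in` is the same at the head
    -- copy, with the colours exchanged.
    red-out : ∀ v → dirdeg r R′ v + b2n (outOdd v) * b2n (false == σ (inj₂ v)) ≡
                    dirdeg r B′ v + b2n (outOdd v) * b2n (false == not (σ (inj₂ v)))
    red-out v = subst₂ _≡_ (cong₂ _+_ (sum-cong tails) (aux-part v false (λ b → b)))
                           (cong₂ _+_ (sum-cong tails′) (aux-part v false not)) (second-balanced (at v false))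
      where
      tails : ∀ e → b2n (Q e) * at v false (doubled (inj₁ e) (σ (inj₁ e))) ≡ b2n (R′ e) * b2n (⁅ v ⁆ (end e (r e)))
      tails e with σ (inj₁ e)
      ... | true  = ≡ᵇ⇒≡ _ _ (truth-table 3 (λ q x y → b2n q * b2n (x ∧ false) ≡ᵇ b2n (q ∧ false) * b2n y) _ (Q e) (⁅ v ⁆ (end e (not (r e)))) (⁅ v ⁆ (end e (r e))))
      ... | false = ≡ᵇ⇒≡ _ _ (truth-table 2 (λ q x → b2n q * b2n (x ∧ true) ≡ᵇ b2n (q ∧ true) * b2n x) _ (Q e) (⁅ v ⁆ (end e (r e))))
      tails′ : ∀ e → b2n (Q e) * at v false (doubled (inj₁ e) (not (σ (inj₁ e)))) ≡ b2n (B′ e) * b2n (⁅ v ⁆ (end e (r e)))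
      tails′ e with σ (inj₁ e)
      ... | false = ≡ᵇ⇒≡ _ _ (truth-table 3 (λ q x y → b2n q * b2n (x ∧ false) ≡ᵇ b2n (q ∧ not (q ∧ true)) * b2n y) _ (Q e) (⁅ v ⁆ (end e (not (r e)))) (⁅ v ⁆ (end e (r e))))
      ... | true  = ≡ᵇ⇒≡ _ _ (truth-table 2 (λ q x → b2n q * b2n (x ∧ true) ≡ᵇ b2n (q ∧ not (q ∧ false)) * b2n x) _ (Q e) (⁅ v ⁆ (end e (r e))))

    red-in : ∀ v → dirdeg (not ∘ r) B′ v + b2n (outOdd v) * b2n (true == σ (inj₂ v)) ≡
                   dirdeg (not ∘ r) R′ v + b2n (outOdd v) * b2n (true == not (σ (inj₂ v)))
    red-in v = subst₂ _≡_ (cong₂ _+_ (sum-cong heads′) (aux-part v true (λ b → b)))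
                          (cong₂ _+_ (sum-cong heads″) (aux-part v true not)) (second-balanced (at v true))
      where
      heads′ : ∀ e → b2n (Q e) * at v true (doubled (inj₁ e) (σ (inj₁ e))) ≡ b2n (B′ e) * b2n (⁅ v ⁆ (end e (not (r e))))
      heads′ e with σ (inj₁ e)
      ... | false = ≡ᵇ⇒≡ _ _ (truth-table 3 (λ q x y → b2n q * b2n (x ∧ false) ≡ᵇ b2n (q ∧ not (q ∧ true)) * b2n y) _ (Q e) (⁅ v ⁆ (end e (r e))) (⁅ v ⁆ (end e (not (r e)))))
      ... | true  = ≡ᵇ⇒≡ _ _ (truth-table 2 (λ q x → b2n q * b2n (x ∧ true) ≡ᵇ b2n (q ∧ not (q ∧ false)) * b2n x) _ (Q e) (⁅ v ⁆ (end e (not (r e)))))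
      heads″ : ∀ e → b2n (Q e) * at v true (doubled (inj₁ e) (not (σ (inj₁ e)))) ≡ b2n (R′ e) * b2n (⁅ v ⁆ (end e (not (r e))))
      heads″ e with σ (inj₁ e)
      ... | true  = ≡ᵇ⇒≡ _ _ (truth-table 3 (λ q x y → b2n q * b2n (x ∧ false) ≡ᵇ b2n (q ∧ false) * b2n y) _ (Q e) (⁅ v ⁆ (end e (r e))) (⁅ v ⁆ (end e (not (r e)))))
      ... | false = ≡ᵇ⇒≡ _ _ (truth-table 2 (λ q x → b2n q * b2n (x ∧ true) ≡ᵇ b2n (q ∧ true) * b2n x) _ (Q e) (⁅ v ⁆ (end e (not (r e)))))

  halves : ∀ v → odd (degIn G R′ v) ≡ odd (degIn G R v) × Near (degIn G R′ v) (degIn G B′ v)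
  halves v = subst₂ (λ x y → odd x ≡ odd (degIn G R v) × Near x y)
    (sym (degIn-dirdeg r R′ v)) (sym (degIn-dirdeg r B′ v))
    (arith (dirdeg r R′ v) (dirdeg r B′ v) _ _ (half v) (outOdd v) (σ (inj₂ v)) (red-out v) (red-in v)
      (trans (sym (cong₂ _+_ (degIn-dirdeg r R′ v) (degIn-dirdeg r B′ v))) (trans (sym (degIn-split Q R′ v R′⊆Q)) (degQ v)))
      (outOdd-half v))
    where
    suc-pair : ∀ a b → (a + b) + (suc a + suc b) ≡ suc (a + b) + suc (a + b)
    suc-pair = solve-∀
    pair-suc : ∀ a b → (suc a + suc b) + (a + b) ≡ suc (a + b) + suc (a + b)
    pair-suc = solve-∀
    two : ∀ a b → suc a + suc b ≡ (a + b) + 2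
    two = solve-∀
    odd-two : ∀ a b → odd (suc a + suc b) ≡ odd (a + b)
    odd-two a b = trans (cong (odd ∘ suc) (+-suc a b)) (not-involutive _)
    xor-suc : ∀ {x y z} → not x ≡ y → true ≡ y xor z → x ≡ z
    xor-suc {true}  {z = true}  refl _ = refl
    xor-suc {false} {z = false} refl _ = refl
    -- `s` is half the degree in `Q`. Without the extra edge both colours get degree s. With it,
    -- that edge starts at one copy and ends at the other, so both differences have the same sign
    -- and the degrees are s - 1 and s + 1. Either way the parity is the prescribed `p`.
    arith : ∀ x₊ y₊ x₋ y₋ s o c {p} →
      x₊ + b2n o * b2n (false == c) ≡ y₊ + b2n o * b2n (false == not c) →
      y₋ + b2n o * b2n (true == c) ≡ x₋ + b2n o * b2n (true == not c) →
      (x₊ + x₋) + (y₊ + y₋) ≡ s + s → o ≡ odd s xor p →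
      odd (x₊ + x₋) ≡ p × Near (x₊ + x₋) (y₊ + y₋)
    arith x₊ y₊ x₋ y₋ s false c {p} a b d q
      rewrite +-identityʳ x₊ | +-identityʳ y₊ | +-identityʳ x₋ | +-identityʳ y₋ | a | b =
      trans (cong odd (double-injective {y₊ + x₋} {s} d)) (xor-false q) , m≤m+n _ 2 , m≤m+n _ 2
      where
      xor-false : ∀ {x y} → false ≡ x xor y → x ≡ y
      xor-false {true}  {true}  _ = refl
      xor-false {false} {false} _ = refl
    arith x₊ y₊ x₋ y₋ s true false {p} a b d q
      rewrite +-identityʳ y₊ | +-identityʳ y₋ | sym a | b | +-comm x₊ 1 | +-comm x₋ 1 =
      xor-suc (cong odd (double-injective {suc (x₊ + x₋)} {s} (trans (sym (suc-pair x₊ x₋)) d))) q ,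
      ≤-trans (m≤m+n _ 2) (≤-trans (≤-reflexive (sym (two x₊ x₋))) (m≤m+n _ 2)) , ≤-reflexive (two x₊ x₋)
    arith x₊ y₊ x₋ y₋ s true true {p} a b d q
      rewrite +-identityʳ x₊ | +-identityʳ x₋ | a | sym b | +-comm y₊ 1 | +-comm y₋ 1 =
      trans (odd-two y₊ y₋) (xor-suc (cong odd (double-injective {suc (y₊ + y₋)} {s} (trans (sym (pair-suc y₊ y₋)) d))) q) ,
      ≤-reflexive (two y₊ y₋) , ≤-trans (m≤m+n _ 2) (≤-trans (≤-reflexive (sym (two y₊ y₋))) (m≤m+n _ 2))

  halve : ∃ (Halving G Q R)
  halve = R′ , R′⊆Q , halves

-- Equalising degrees

square : ℕ → ℕ
square x = x * x

-- The two sums of squares differ by 2(x - y)p. As `p` is even, it is zero or at least 2, and in the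
-- latter case the bound gives y ≤ x.
squares-shift : ∀ x y p → odd p ≡ false → y + p ≤ x + 2 →
                square x + square (y + p) ≤ square (x + p) + square y ×
                (y + 2 < x + p → x ≤ y + p + 2 → square x + square (y + p) < square (x + p) + square y)
squares-shift x y zero even le rewrite +-identityʳ x | +-identityʳ y =
  ≤-refl , λ lt le′ → contradiction lt (≤⇒≯ le′)
squares-shift x y (suc (suc p)) even le = subst
  (λ x → square x + square (y + P) ≤ square (x + P) + square y ×
         (y + 2 < x + P → x ≤ y + P + 2 → square x + square (y + P) < square (x + P) + square y))
  (m+[n∸m]≡n y≤x) (≤-trans (m≤m+n _ _) (≤-reflexive (sym (gap (x ∸ y)))) , λ lt _ → strict (x ∸ y) (m+[n∸m]≡n y≤x) lt)
  where
  P = suc (suc p)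
  y≤x : y ≤ x
  y≤x = +-cancelʳ-≤ 2 y x (≤-trans (+-monoʳ-≤ y (s≤s (s≤s z≤n))) le)
  gap : ∀ d → square (y + d + P) + square y ≡ (square (y + d) + square (y + P)) + 2 * (d * P)
  gap d = identity y d P
    where
    identity : ∀ y d p → (y + d + p) * (y + d + p) + y * y ≡ ((y + d) * (y + d) + (y + p) * (y + p)) + 2 * (d * p)
    identity = solve-∀
  strict : ∀ d → y + d ≡ x → y + 2 < y + d + P → square (y + d) + square (y + P) < square (y + d + P) + square y
  strict zero eq lt rewrite +-identityʳ y | sym eq = contradiction lt (≤⇒≯ le)
  strict (suc d) eq lt = subst (square (y + suc d) + square (y + P) <_) (sym (gap (suc d))) (m<m+n _ z<s)

-- Equal sums and equal parities make the change an even transfer, in one direction or the other, to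
-- which `squares-shift` applies. If `x` grows or stays, nearness of the new pair excludes
-- `y + 2 < x`.
squares-near : ∀ x y x′ y′ → x + y ≡ x′ + y′ → odd x ≡ odd x′ → x′ ≤ y′ + 2 → y′ ≤ x′ + 2 →
               square x′ + square y′ ≤ square x + square y ×
               (y + 2 < x → square x′ + square y′ < square x + square y)
squares-near x y x′ y′ sum par le le′ with ≤-total x′ x
... | inj₁ x′≤x = subst₂ (λ a b → square x′ + square a ≤ square b + square y × (y + 2 < b → square x′ + square a < square b + square y))
                    (sym y′≡) x≡ (proj₁ shift , λ lt → proj₂ shift lt (subst (λ z → x′ ≤ z + 2) y′≡ le))
  where
  p = x ∸ x′
  x≡ : x′ + p ≡ x
  x≡ = m+[n∸m]≡n x′≤x
  y′≡ : y′ ≡ y + p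
  y′≡ = +-cancelˡ-≡ x′ y′ (y + p) (trans (sym sum) (trans (cong (_+ y) (sym x≡)) (rotate x′ p y)))
    where
    rotate : ∀ a b c → a + b + c ≡ a + (c + b)
    rotate = solve-∀
  even : odd p ≡ false
  even = xor-cancel (odd x′) (trans (sym (odd-+ x′ p)) (trans (cong odd x≡) par))
    where
    xor-cancel : ∀ a {b} → a xor b ≡ a → b ≡ false
    xor-cancel false q = q
    xor-cancel true {false} q = refl
  shift = squares-shift x′ y p even (subst (_≤ x′ + 2) y′≡ le′)
... | inj₂ x≤x′ = subst₂ (λ a b → square a + square y′ ≤ square x + square b) x≡ y≡
                    (subst₂ _≤_ (+-comm (square y′) _) (+-comm (square (y′ + p)) _) (proj₁ shift)) ,
                  λ lt → contradiction (<-≤-trans lt x≤x′) (≤⇒≯ (≤-trans le (+-monoˡ-≤ 2 (subst (y′ ≤_) y≡ (m≤m+n y′ p)))))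
  where
  p = x′ ∸ x
  x≡ : x + p ≡ x′
  x≡ = m+[n∸m]≡n x≤x′
  y≡ : y′ + p ≡ y
  y≡ = sym (+-cancelˡ-≡ x y (y′ + p) (trans sum (trans (cong (_+ y′) (sym x≡)) (rotate x p y′))))
    where
    rotate : ∀ a b c → a + b + c ≡ a + (c + b)
    rotate = solve-∀
  even : odd p ≡ false
  even = xor-cancel (odd x) (trans (sym (odd-+ x p)) (trans (cong odd x≡) (sym par)))
    where
    xor-cancel : ∀ a {b} → a xor b ≡ a → b ≡ false
    xor-cancel false q = q
    xor-cancel true {false} q = refl
  shift = squares-shift y′ x p even (subst (_≤ y′ + 2) (sym x≡) le)

module Balance (G : Graph) {k : ℕ} (f : Vertex G → Bool) where
  open Degrees G

  Colouring : Set
  Colouring = Edge G → Fin k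

  d : Colouring → Fin k → Vertex G → ℕ
  d c i v = degIn G (factor G c i) v

  IsParity : Colouring → Set
  IsParity c = ∀ i v → odd (d c i v) ≡ f v

  squaresOf : Colouring → Fin k → ℕ
  squaresOf c i = sumFin (n G) (λ v → square (d c i v))

  Φ : Colouring → ℕ
  Φ c = sumFin k (squaresOf c)

  module Rebalance (c : Colouring) (c-parity : IsParity c) {i j : Fin k} (i≢j : i ≢ j) where

    Q : EdgeSet G
    Q = factor G c i ∪ factor G c j

    factor-i⊆Q : factor G c i ⊆ Q
    factor-i⊆Q e p = cong (_∨ factor G c j e) p

    rest≡j : Q ∖ factor G c i ≗ factor G c j
    rest≡j e with c e ≟ i | c e ≟ j
    ... | yes p | yes q = contradiction (trans (sym p) q) i≢j
    ... | yes _ | no _  = refl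
    ... | no _  | yes _ = refl
    ... | no _  | no _  = refl

    degQ-sum : ∀ v → degIn G Q v ≡ d c i v + d c j v
    degQ-sum v = trans (degIn-split Q (factor G c i) v factor-i⊆Q) (cong (d c i v +_) (degIn-cong rest≡j v))

    even : ∀ v → odd (degIn G Q v) ≡ false
    even v = trans (cong odd (degQ-sum v)) (trans (odd-+ (d c i v) _)
               (trans (cong₂ _xor_ (c-parity i v) (c-parity j v)) (xor-same (f v))))

    halved : ∃ (Halving G Q (factor G c i))
    halved = Halve.halve G Q (factor G c i) factor-i⊆Q even

    module Recolour (R′ : EdgeSet G) (R′⊆Q : R′ ⊆ Q)
      (halves : ∀ v → odd (degIn G R′ v) ≡ odd (degIn G (factor G c i) v) × Near (degIn G R′ v) (degIn G (Q ∖ R′) v)) where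

      B′ : EdgeSet G
      B′ = Q ∖ R′

      c′ : Colouring
      c′ e = if Q e then (if R′ e then i else j) else c e

      c′-cases : ∀ e l → factor G c′ l e ≡ (if Q e then (if R′ e then does (i ≟ l) else does (j ≟ l)) else factor G c l e)
      c′-cases e l with Q e
      ... | false = refl
      ... | true with R′ e
      ...   | true  = refl
      ...   | false = refl

      c′-i : factor G c′ i ≗ R′
      c′-i e = trans (c′-cases e i) (cases (Q e) (R′ e) (R′⊆Q e) λ Qe → ∨-falseˡ Qe)
        where
        ∨-falseˡ : ∀ {a b} → a ∨ b ≡ false → a ≡ false
        ∨-falseˡ {false} _ = refl
        cases : ∀ q r → (r ≡ true → q ≡ true) → (q ≡ false → factor G c i e ≡ false) →
                (if q then (if r then does (i ≟ i) else does (j ≟ i)) else factor G c i e) ≡ r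
        cases true  true  _ _ = does-refl i
        cases true  false _ _ = dec-false (j ≟ i) (i≢j ∘ sym)
        cases false true  p _ = case p refl of λ ()
        cases false false _ p = p refl

      c′-j : factor G c′ j ≗ B′
      c′-j e = trans (c′-cases e j) (cases (Q e) (R′ e) λ Qe → ∨-falseʳ {factor G c i e} Qe)
        where
        ∨-falseʳ : ∀ {a b} → a ∨ b ≡ false → b ≡ false
        ∨-falseʳ {false} p = p
        cases : ∀ q r → (q ≡ false → factor G c j e ≡ false) →
                (if q then (if r then does (i ≟ j) else does (j ≟ j)) else factor G c j e) ≡ q ∧ not r
        cases true  true  _ = dec-false (i ≟ j) i≢j
        cases true  false _ = does-refl j
        cases false _     p = p refl

      c′-other : ∀ l → l ≢ i → l ≢ j → factor G c′ l ≗ factor G c l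
      c′-other l l≢i l≢j e = trans (c′-cases e l) cases
        where
        cases : (if Q e then (if R′ e then does (i ≟ l) else does (j ≟ l)) else factor G c l e) ≡ factor G c l e
        cases with c e ≟ i | c e ≟ j | c e ≟ l | R′ e
        ... | no _  | no _  | _     | _ = refl
        ... | yes p | _     | yes q | _ = contradiction (trans (sym q) p) l≢i
        ... | no _  | yes p | yes q | _ = contradiction (trans (sym q) p) l≢j
        ... | yes p | _     | no q  | true  = dec-false (i ≟ l) (l≢i ∘ sym)
        ... | yes p | _     | no q  | false = dec-false (j ≟ l) (l≢j ∘ sym)
        ... | no _  | yes p | no q  | true  = dec-false (i ≟ l) (l≢i ∘ sym)
        ... | no _  | yes p | no q  | false = dec-false (j ≟ l) (l≢j ∘ sym)

      d-i : ∀ v → d c′ i v ≡ degIn G R′ v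
      d-i = degIn-cong c′-i

      d-j : ∀ v → d c′ j v ≡ degIn G B′ v
      d-j = degIn-cong c′-j

      same-sum : ∀ v → d c i v + d c j v ≡ d c′ i v + d c′ j v
      same-sum v = trans (sym (degQ-sum v)) (trans (degIn-split Q R′ v R′⊆Q) (sym (cong₂ _+_ (d-i v) (d-j v))))

      parity-i : ∀ v → odd (d c′ i v) ≡ f v
      parity-i v = trans (cong odd (d-i v)) (trans (proj₁ (halves v)) (c-parity i v))

      c′-parity : IsParity c′
      c′-parity l v with l ≟ i | l ≟ j
      ... | yes refl | _        = parity-i v
      ... | no _     | yes refl = cancel (f v) (begin
            f v xor odd (d c′ j v)           ≡⟨ cong (_xor odd (d c′ j v)) (sym (parity-i v)) ⟩
            odd (d c′ i v) xor odd (d c′ j v) ≡⟨ sym (odd-+ (d c′ i v) _) ⟩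
            odd (d c′ i v + d c′ j v)        ≡⟨ cong odd (sym (same-sum v)) ⟩
            odd (d c i v + d c j v)          ≡⟨ trans (cong odd (sym (degQ-sum v))) (even v) ⟩
            false                            ∎)
        where
        open ≡-Reasoning
        cancel : ∀ a {b} → a xor b ≡ false → b ≡ a
        cancel true  {true}  _ = refl
        cancel false {false} _ = refl
      ... | no l≢i   | no l≢j   = trans (cong odd (degIn-cong (c′-other l l≢i l≢j) v)) (c-parity l v)

      improvement : ∀ v → square (d c′ i v) + square (d c′ j v) ≤ square (d c i v) + square (d c j v) ×
                          (d c j v + 2 < d c i v →
                           square (d c′ i v) + square (d c′ j v) < square (d c i v) + square (d c j v))
      improvement v = squares-near (d c i v) (d c j v) (d c′ i v) (d c′ j v) (same-sum v)
        (trans (c-parity i v) (sym (parity-i v)))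
        (subst₂ (λ x y → x ≤ y + 2) (sym (d-i v)) (sym (d-j v)) (proj₁ (proj₂ (halves v))))
        (subst₂ (λ x y → x ≤ y + 2) (sym (d-j v)) (sym (d-i v)) (proj₂ (proj₂ (halves v))))

      -- Only the colours `i` and `j` change; their squared degrees grow at no vertex and drop
      -- strictly at `v`.
      Φ-decreases : ∀ {v} → d c j v + 2 < d c i v → Φ c′ < Φ c
      Φ-decreases {v} far = +-cancelʳ-< (squaresOf c i + squaresOf c j) (Φ c′) (Φ c)
        (subst (_< Φ c + (squaresOf c i + squaresOf c j)) exchange
          (+-monoʳ-< (Φ c) (sum-+-< {n G} (λ v → proj₁ (improvement v)) v (proj₂ (improvement v) far))))
        where
        exchange : Φ c + (squaresOf c′ i + squaresOf c′ j) ≡ Φ c′ + (squaresOf c i + squaresOf c j)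
        exchange = sum-exchange₂ (squaresOf c) (squaresOf c′) i≢j λ l l≢i l≢j →
          sum-cong λ v → cong square (sym (degIn-cong (c′-other l l≢i l≢j) v))

  balance : ∀ fuel c → IsParity c → Φ c ≤ fuel → ∃ λ c → IsParity c × (∀ i j v → d c i v ≤ d c j v + 2)
  balance fuel c c-parity bound with any? (λ i → any? (λ j → any? (λ v → d c j v + 2 <? d c i v)))
  ... | no ¬far = c , c-parity , λ i j v → ≮⇒≥ λ far → ¬far (i , j , v , far)
  ... | yes (i , j , v , far) = next fuel bound halved
    where
    i≢j : i ≢ j
    i≢j refl = <⇒≱ far (m≤m+n _ 2)
    open Rebalance c c-parity i≢j
    next : ∀ fuel → Φ c ≤ fuel → ∃ (Halving G Q (factor G c i)) →
           ∃ λ c → IsParity c × (∀ i j v → d c i v ≤ d c j v + 2)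
    next zero    bound (R′ , R′⊆Q , halves) =
      contradiction (<-≤-trans (Recolour.Φ-decreases R′ R′⊆Q halves far) bound) λ ()
    next (suc b) bound (R′ , R′⊆Q , halves) = let open Recolour R′ R′⊆Q halves in
      balance b c′ c′-parity (≤-pred (<-≤-trans (Φ-decreases far) bound))

  sum-factors : ∀ c v → sumFin k (λ i → d c i v) ≡ deg G v
  sum-factors c v = trans (sum-swap (λ i e → b2n (factor G c i e) * incid G e v)) (sum-cong λ e →
    trans (sum-cong λ i → cong (λ b → b2n b * incid G e v) (does-sym (c e) i))
          (trans (sum-single (c e) (λ _ → incid G e v)) (sym (+-identityʳ _))))

  -- The bound is multiplied by `k` to stay within natural numbers. Summing the pairwise bounds over
  -- all colours gives it, strictly because comparing colour `i` with itself leaves a slack of 2.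
  near-average : ∀ c → (∀ i j v → d c i v ≤ d c j v + 2) → ∀ i v →
                 k * d c i v < deg G v + 2 * k × deg G v < k * d c i v + 2 * k
  near-average c near i v =
    subst₂ _<_ (sum-const k (d c i v)) (sum-plus-2 (λ j → d c j v) (sum-factors c v))
      (sum-mono-< {k} (λ j → near i j v) i (m<m+n (d c i v) z<s)) ,
    subst₂ _<_ (sum-factors c v) (sum-plus-2 (λ _ → d c i v) (sum-const k (d c i v)))
      (sum-mono-< {k} (λ j → near j i v) i (m<m+n (d c i v) z<s))
    where
    sum-const : ∀ k x → sumFin k (λ _ → x) ≡ k * x
    sum-const zero    x = refl
    sum-const (suc k) x = cong (x +_) (sum-const k x)
    sum-plus-2 : ∀ (g : Fin k → ℕ) {x} → sumFin k g ≡ x → sumFin k (λ j → g j + 2) ≡ x + 2 * k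
    sum-plus-2 g eq = trans (sum-+ g (λ _ → 2)) (cong₂ _+_ eq (trans (sum-const k 2) (*-comm k 2)))

-- From the hypotheses to a decomposition into parity factors

sum-at-most-one : ∀ {m} (g : Fin m → Bool) {b} → (∀ i → g i ≡ true → b ≡ true) →
                  (∀ i j → g i ≡ true → g j ≡ true → i ≡ j) → sumFin m (b2n ∘ g) ≤ b2n b
sum-at-most-one {zero}  g imp uniq = z≤n
sum-at-most-one {suc m} g imp uniq with g zero in g₀
... | false = sum-at-most-one (g ∘ suc) (imp ∘ suc) λ i j p q → suc-injective (uniq (suc i) (suc j) p q)
... | true rewrite imp zero g₀ = s≤s (≤-reflexive (sum-zero {m} λ i → cong b2n (¬-not λ gi → case uniq zero (suc i) g₀ gi of λ ())))

xsum-const : ∀ m b → xsum m (λ _ → b) ≡ odd m ∧ b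
xsum-const zero    b = refl
xsum-const (suc m) b rewrite xsum-const m b = ==⇒≡ (truth-table 2 (λ o b → (b xor (o ∧ b)) == (not o ∧ b)) _ (odd m) b)

even-multiple : ∀ {k} → 2 ∣ k → odd k ≡ false
even-multiple (divides q refl) = trans (cong odd (*-comm q 2)) (trans (odd-+ q (q + 0))
  (trans (cong (λ z → odd q xor odd z) (+-identityʳ q)) (xor-same (odd q))))

weightLin : ∀ {n} → VS n → Lin n
weightLin {n} f = record
  { ap  = λ X → xsum n (λ v → X v ∧ f v)
  ; ext = λ eq → xsum-cong λ v → cong (_∧ f v) (eq v)
  ; add = λ X Y → trans (xsum-cong λ v → ==⇒≡ (truth-table 3 (λ a b c → ((a xor b) ∧ c) == ((a ∧ c) xor (b ∧ c))) _ (X v) (Y v) (f v)))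
                        (xsum-xor (λ v → X v ∧ f v) _) }

module _ (G : Graph) where

  crosses : VSet G → Edge G → Bool
  crosses X e = X (proj₁ (ends G e)) xor X (proj₂ (ends G e))

  reach-crosses : ∀ {S} (X : VSet G) {u v} → Reach G S u v → X u ≡ false → X v ≡ true →
                  ∃ λ e → S e ∧ crosses X e ≡ true
  reach-crosses X here Xu Xv = false≢true Xu Xv
  reach-crosses X (fwd e Se path) Xu Xv with X (proj₁ (ends G e)) in Xa
  ... | true  = reach-crosses X path Xu Xa
  ... | false = e , cong₂ _∧_ Se (cong₂ _xor_ Xa Xv)
  reach-crosses X (bwd e Se path) Xu Xv with X (proj₂ (ends G e)) in Xb
  ... | true  = reach-crosses X path Xu Xb
  ... | false = e , cong₂ _∧_ Se (cong₂ _xor_ Xv Xb)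

  -- Each connected tree has an edge crossing `X`, and by disjointness every crossing edge is
  -- counted for at most one tree.
  tree-cut : ∀ {s} → TreeConnected s G → ∀ X {u v} → X u ≡ false → X v ≡ true → s ≤ cut G X
  tree-cut {s} (T , trees , disjoint) X {u} {v} Xu Xv = begin
    s                                                              ≡⟨ sym (sum-one s) ⟩
    sumFin s (λ _ → 1)                                             ≤⟨ sum-mono crossed ⟩
    sumFin s (λ j → sumFin (m G) (λ e → b2n (T j e ∧ crosses X e))) ≡⟨ sum-swap (λ j e → b2n (T j e ∧ crosses X e)) ⟩
    sumFin (m G) (λ e → sumFin s (λ j → b2n (T j e ∧ crosses X e))) ≤⟨ sum-mono once ⟩
    cut G X                                                        ∎
    where
    open ≤-Reasoning
    crossed : ∀ j → 1 ≤ sumFin (m G) (λ e → b2n (T j e ∧ crosses X e))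
    crossed j with reach-crosses X (proj₁ (trees j) u v) Xu Xv
    ... | e , p = ≤-trans (≤-reflexive (cong b2n (sym p))) (term≤sum (λ e → b2n (T j e ∧ crosses X e)) e)
    once : ∀ e → sumFin s (λ j → b2n (T j e ∧ crosses X e)) ≤ b2n (crosses X e)
    once e = sum-at-most-one (λ j → T j e ∧ crosses X e) (λ j → ∧-trueʳ {T j e})
               λ i j p q → disjoint i j e (∧-trueˡ p) (∧-trueˡ q)

  -- With k = l + 1 the target is 2(k - 1), which is exactly the number of trees, and 3k - 2 = 2l +
  -- (l + 1) exceeds it.
  large-cuts : ∀ l (f : VSet G) → fsum G f (allV G) % 2 ≡ 0 →
    ((∀ (X : VSet G) → fsum G f X % 2 ≡ 1 → 3 * suc l ∸ 2 ≤ cut G X) ⊎ TreeConnected (2 * suc l ∸ 2) G) →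
    ∀ X → ap (weightLin f) X ≡ true → l + l ≤ cut G X
  large-cuts l f even (inj₁ large) X FX = ≤-trans bound (large X odd-X)
    where
    odd-X : fsum G f X % 2 ≡ 1
    odd-X = trans (%2≡odd (fsum G f X)) (cong b2n (trans (sym (xsum≡odd (λ v → X v ∧ f v))) FX))
    bound : l + l ≤ 3 * suc l ∸ 2
    bound = subst (l + l ≤_) (sym (trans (cong (_∸ 2) (three l)) (m+n∸n≡m (l + l + suc l) 2))) (m≤m+n (l + l) _)
      where
      three : ∀ l → 3 * suc l ≡ l + l + suc l + 2
      three = solve-∀
  large-cuts l f even (inj₂ trees) X FX = subst (_≤ cut G X) two (tree-cut trees X (proj₂ outside) (∧-trueˡ (proj₂ inside)))
    where
    inside = xsum-true (λ v → X v ∧ f v) FX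
    F⊤ : ap (weightLin f) ⊤ₛ ≡ false
    F⊤ = trans (xsum≡odd f) (b2n-injective (trans (sym (%2≡odd (fsum G f (allV G)))) even))
    -- An odd set cannot contain every vertex, since `f` has even total; together with `inside` this
    -- makes the cut nontrivial, as `tree-cut` requires.
    outside : ∃ λ v → X v ≡ false
    outside with any? (λ v → X v Bool.≟ false)
    ... | yes p = p
    ... | no ¬p = false≢true F⊤ (trans (ext (weightLin f) λ v → sym (¬-not λ q → ¬p (v , q))) FX)
    two : 2 * suc l ∸ 2 ≡ l + l
    two = trans (cong (_∸ 2) (double l)) (m+n∸n≡m (l + l) 2)
      where
      double : ∀ l → 2 * suc l ≡ l + l + 2
      double = solve-∀

  module FromPacking {l} (f : VSet G) (odd-l : odd l ≡ true) (even : ∀ v → odd (deg G v) ≡ false) where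
    open Degrees G
    open Balance G {suc l} f

    weight-singleton : ∀ v → ap (weightLin f) ⁅ v ⁆ ≡ f v
    weight-singleton v = xsum-single v f

    -- Colours 1, …, l are the members of the packing; colour 0 is the remainder.
    colouring : Packing (λ e → end e false) (λ e → end e true) l (weightLin f) → ∃ IsParity
    colouring (J , disjoint , J-parity) = c , c-parity
      where
      member? : ∀ e → Dec (∃ λ i → J i e ≡ true)
      member? e = any? λ i → J i e Bool.≟ true
      colour : ∀ {e} → Dec (∃ λ i → J i e ≡ true) → Fin (suc l)
      colour (yes (i , _)) = suc i
      colour (no _)        = zero
      c : Colouring
      c e = colour (member? e)
      c-suc : ∀ i → factor G c (suc i) ≗ J i
      c-suc i e with member? e
      ... | no ¬p = sym (¬-not λ q → ¬p (i , q))
      ... | yes (j , p) with j ≟ i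
      ...   | yes refl = sym p
      ...   | no j≢i   = sym (¬-not λ q → j≢i (disjoint j i e p q))
      c-parity : IsParity c
      c-parity (suc i) v = trans (cong odd (degIn-cong (c-suc i) v))
        (trans (odd-degIn (J i) v) (trans (J-parity i ⁅ v ⁆) (weight-singleton v)))
      -- The degree of v is even and each of the `l` other colours contributes f(v); as `l` is odd,
      -- the remainder has parity f(v) too.
      c-parity zero v = cancel (begin
        odd (d c zero v) xor f v ≡⟨ cong (λ b → odd (d c zero v) xor (b ∧ f v)) (sym odd-l) ⟩
        odd (d c zero v) xor (odd l ∧ f v) ≡⟨ cong (odd (d c zero v) xor_) (sym (xsum-const l (f v))) ⟩
        odd (d c zero v) xor xsum l (λ _ → f v) ≡⟨ cong (odd (d c zero v) xor_) (xsum-cong λ i → sym (c-parity (suc i) v)) ⟩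
        xsum (suc l) (λ i → odd (d c i v)) ≡⟨ sym (odd-sum (λ i → d c i v)) ⟩
        odd (sumFin (suc l) (λ i → d c i v)) ≡⟨ cong odd (sum-factors c v) ⟩
        odd (deg G v) ≡⟨ even v ⟩
        false ∎)
        where
        open ≡-Reasoning
        cancel : ∀ {a b} → a xor b ≡ false → a ≡ b
        cancel {true}  {true}  _ = refl
        cancel {false} {false} _ = refl

    orientation : ∃ λ (s : Edge G → Bool) → Balanced (λ e → end e (s e)) (λ e → end e (not (s e)))
    orientation with euler _≟_ (m G) end (λ _ → true) (even-degIn (allE G) even)
    ... | s , balanced = s , λ φ → trans (sum-cong {m G} λ e → sym (+-identityʳ (φ (end e (s e)))))
                               (trans (balanced φ) (sum-cong {m G} λ e → +-identityʳ (φ (end e (not (s e))))))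

    xor-end : ∀ b (g : Bool → Bool) → g b xor g (not b) ≡ g false xor g true
    xor-end false g = refl
    xor-end true  g = xor-comm (g true) _

    -- In an Eulerian orientation exactly half of every cut enters the set, so a cut of size 2l
    -- gives indegree l. The induction of `pack` starts with all vertices, a set that no arc
    -- crosses.
    parity-factors : (∀ X → ap (weightLin f) X ≡ true → l + l ≤ cut G X) → ap (weightLin f) ⊤ₛ ≡ false → ∃ IsParity
    parity-factors large F⊤ with orientation
    ... | s , balanced = colouring (unorient (pack (card {n G} ⊤ₛ) ⊤ₛ t h (weightLin f) ≤-refl 0<l balanced cuts F⊤
                                              (λ X p → ap-∅ (weightLin f) λ v → p v refl) (λ _ → refl)))
      where
      t h : Edge G → Vertex G
      t e = end e (s e)
      h e = end e (not (s e))
      0<l : 0 < l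
      0<l = n≢0⇒n>0 λ { refl → case odd-l of λ () }
      cut≡ρ : ∀ X → cut G X ≡ ρ t h ⊤ₛ X + ρ t h ⊤ₛ X
      cut≡ρ X = begin
        cut G X                          ≡⟨ sum-cong (λ e → trans (cong b2n (sym (xor-end (s e) (X ∘ end e)))) (pointwise (X (t e)) (X (h e)))) ⟩
        sumFin (m G) (λ e → b2n (not (X (t e)) ∧ X (h e)) + b2n (not (not (X (t e))) ∧ not (X (h e)))) ≡⟨ sum-+ (λ e → b2n (not (X (t e)) ∧ X (h e))) _ ⟩
        ρ t h ⊤ₛ X + ρ t h ⊤ₛ (∁ X)      ≡⟨ cong (ρ t h ⊤ₛ X +_) (balanced-∁ t h balanced X) ⟩
        ρ t h ⊤ₛ X + ρ t h ⊤ₛ X          ∎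
        where
        open ≡-Reasoning
        pointwise : ∀ a b → b2n (a xor b) ≡ b2n (not a ∧ b) + b2n (not (not a) ∧ not b)
        pointwise a b = ≡ᵇ⇒≡ _ _ (truth-table 2 (λ a b → b2n (a xor b) ≡ᵇ b2n (not a ∧ b) + b2n (not (not a) ∧ not b)) _ a b)
      cuts : LargeCuts t h l (weightLin f)
      cuts X FX = ≮⇒≥ λ small → <⇒≱ (+-mono-< small small) (subst (l + l ≤_) (cut≡ρ X) (large X FX))
      unorient : Packing t h l (weightLin f) → Packing (λ e → end e false) (λ e → end e true) l (weightLin f)
      unorient (J , disjoint , J-parity) = J , disjoint , λ i X →
        trans (xsum-cong λ e → cong (J i e ∧_) (sym (xor-end (s e) (X ∘ end e)))) (J-parity i X)

theorem4p4 : (k : ℕ) → 1 ≤ k → 2 ∣ k → (G : Graph) →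
    (∀ v → deg G v % 2 ≡ 0) →
    (f : Vertex G → Bool) → fsum G f (allV G) % 2 ≡ 0 →
    ((∀ (X : VSet G) → fsum G f X % 2 ≡ 1 → 3 * k ∸ 2 ≤ cut G X)
    ⊎ TreeConnected (2 * k ∸ 2) G) →
    Σ (Edge G → Fin k) λ c →
    (∀ i → IsParityFactor G f (factor G c i)) ×
    (∀ i v → k * degIn G (factor G c i) v < deg G v + 2 * k
    × deg G v < k * degIn G (factor G c i) v + 2 * k)
theorem4p4 (suc l) 1≤k 2∣k G even f f-even hyp = finish (parity-factors (large-cuts G l f f-even hyp) F⊤)
  where
  odd-l : odd l ≡ true
  odd-l = trans (sym (not-involutive (odd l))) (cong not (even-multiple 2∣k))
  open FromPacking G {l} f odd-l (λ v → b2n-injective (trans (sym (%2≡odd (deg G v))) (even v)))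
  open Balance G {suc l} f
  F⊤ : ap (weightLin f) ⊤ₛ ≡ false
  F⊤ = trans (xsum≡odd f) (b2n-injective (trans (sym (%2≡odd (fsum G f (allV G)))) f-even))
  finish : ∃ IsParity → Σ (Edge G → Fin (suc l)) _
  finish (c₀ , c₀-parity) with balance (Φ c₀) c₀ c₀-parity ≤-refl
  ... | c , c-parity , near = c , (λ i v → trans (%2≡odd (d c i v)) (cong b2n (c-parity i v))) , near-average c near
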